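{- For any $u<w$ in $W$ with $u\in c_0$, $w\in c_1$ and $l(w)-l(u)\ge5$, we have $\mu(u,w)=0$.
   Context: $W$ is the affine Weyl group of type $\widetilde A_2$: the Coxeter group on $S=\{r,s,t\}$ with $(rs)^3=(st)^3=(rt)^3=1$, with length $l$ and Bruhat order $\le$. For $u<w$, $\mu(u,w)$ is the coefficient of $q^{(l(w)-l(u)-1)/2}$ in the Kazhdan–Lusztig polynomial $P_{u,w}$. $c_1$ is the set of elements $w\neq e$ having a unique reduced expression (the two-sided cell of $\mathbf a$-value 1), and $c_0=W\setminus(\{e\}\cup c_1)$ (the two-sided cell of $\mathbf a$-value 3). -}

module Defs where

open import Data.Nat using (ℕ; zero; suc; _<_; _≤_; _∸_; ⌊_/2⌋)
open import Data.Integer using (ℤ; 0ℤ; 1ℤ; _+_; _-_; _*_)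
open import Data.List using (List; []; _∷_; _++_; length; reverse; foldr)
open import Data.List.Membership.Propositional using (_∈_)
open import Data.List.Relation.Unary.Any using (Any)
open import Data.List.Relation.Unary.AllPairs using (AllPairs)
open import Data.Product using (Σ; _×_; _,_)
open import Relation.Binary.PropositionalEquality using (_≡_)
open import Relation.Nullary using (¬_)

-- The Coxeter group W of type Ã₂, by its presentation.
-- Generators S = {r, s, t}; elements are words modulo the congruence
-- generated by a a = 1 and (a b)^3 = 1.  (For a = b the relation
-- (aa)^3 = 1 is a consequence of a² = 1, and (ba)^3 = 1 follows from
-- (ab)^3 = 1, so allowing all pairs gives exactly the presentation
-- (rs)^3 = (st)^3 = (rt)^3 = 1, r² = s² = t² = 1.)

data Gen : Set where
  r s t : Gen

Word : Set
Word = List Gen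

infix 4 _~_
data _~_ : Word → Word → Set where
  ~-refl  : ∀ {w} → w ~ w
  ~-sym   : ∀ {v w} → v ~ w → w ~ v
  ~-trans : ∀ {u v w} → u ~ v → v ~ w → u ~ w
  ~-sq    : ∀ xs a ys → (xs ++ a ∷ a ∷ ys) ~ (xs ++ ys)
  ~-br    : ∀ xs a b ys →
            (xs ++ a ∷ b ∷ a ∷ b ∷ a ∷ b ∷ ys) ~ (xs ++ ys)

Reduced : Word → Set
Reduced w = ∀ v → v ~ w → length w ≤ length v

IsLengthFn : (Word → ℕ) → Set
IsLengthFn ℓ = ∀ w → Σ Word λ v → v ~ w × Reduced v × length v ≡ ℓ w

-- reflections: conjugates y a y⁻¹ of simple reflections (y⁻¹ = reverse y)
IsReflection : Word → Set
IsReflection τ = Σ Word λ y → Σ Gen λ a → τ ~ (y ++ a ∷ reverse y)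

module _ (ℓ : Word → ℕ) where

  data _≤B_ : Word → Word → Set where
    b-refl : ∀ {u w} → u ~ w → u ≤B w
    b-step : ∀ {u v w} τ → IsReflection τ → u ≤B v →
             ℓ v < ℓ (v ++ τ) → (v ++ τ) ~ w → u ≤B w

  _<B_ : Word → Word → Set
  u <B w = (u ≤B w) × ¬ (u ~ w)

InC1 : Word → Set
InC1 w = ¬ (w ~ []) ×
         (∀ v v′ → Reduced v → Reduced v′ → v ~ w → v′ ~ w → v ≡ v′)

InC0 : Word → Set
InC0 w = ¬ (w ~ []) × ¬ InC1 w

-- Polynomials in ℤ[q], as coefficient sequences (k ↦ coefficient of q^k).

Poly : Set
Poly = ℕ → ℤ

infix 4 _≗P_
_≗P_ : Poly → Poly → Set
p ≗P p′ = ∀ k → p k ≡ p′ k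

zeroP : Poly
zeroP _ = 0ℤ

oneP : Poly
oneP zero    = 1ℤ
oneP (suc _) = 0ℤ

_⊕_ : Poly → Poly → Poly
(p ⊕ p′) k = p k + p′ k

_⊖_ : Poly → Poly → Poly
(p ⊖ p′) k = p k - p′ k

scale : ℤ → Poly → Poly
scale c p k = c * p k

shift : ℕ → Poly → Poly
shift zero    p k       = p k
shift (suc m) p zero    = 0ℤ
shift (suc m) p (suc k) = shift m p k

sumP : List Poly → Poly
sumP = foldr _⊕_ zeroP

-- halfCoeff d p = coefficient of q^((d-1)/2) in p if d is odd, 0 if d is even
halfCoeff : ℕ → Poly → ℤ
halfCoeff zero          p = 0ℤ
halfCoeff (suc zero)    p = p 0
halfCoeff (suc (suc d)) p = halfCoeff d (λ k → p (suc k))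

Enumerates : (Word → Set) → List Word → Set
Enumerates Pr Z =
  (∀ z → z ∈ Z → Pr z) ×
  (∀ z → Pr z → Any (λ z′ → z ~ z′) Z) ×
  AllPairs (λ a b → ¬ (a ~ b)) Z

module _ (ℓ : Word → ℕ) (P : Word → Word → Poly) where

  mu : Word → Word → ℤ
  mu u w = halfCoeff (ℓ w ∸ ℓ u) (P u w)

  -- P is the family of Kazhdan–Lusztig polynomials P_{x,w} (with the
  -- convention P_{x,w} = 0 unless x ≤ w), characterised by the
  -- Kazhdan–Lusztig recursion (KL79, (2.2.c)): for s ∈ S, w = s v, v < w,
  --  P_{x,w} = q^{1-c} P_{sx,v} + q^c P_{x,v}
  --            - Σ_{z < v, sz < z} μ(z,v) q^{(l(w)-l(z))/2} P_{x,z},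
  -- c = 1 if sx < x and c = 0 otherwise; together with P_{x,e} = δ_{x,e}.
  record IsKL : Set where
    field
      respects : ∀ {x x′ w w′} → x ~ x′ → w ~ w′ → P x w ≗P P x′ w′
      base-e   : ∀ x → x ~ [] → P x [] ≗P oneP
      base-ne  : ∀ x → ¬ (x ~ []) → P x [] ≗P zeroP
      recursion : ∀ (a : Gen) (v x : Word) → ℓ v < ℓ (a ∷ v) →
        ∀ (Z : List Word) →
        Enumerates (λ z → _<B_ ℓ z v × ℓ (a ∷ z) < ℓ z) Z →
        let Σz = sumP (Data.List.map
                   (λ z → scale (mu z v)
                            (shift ⌊ (ℓ (a ∷ v) ∸ ℓ z) /2⌋ (P x z))) Z)
        in (ℓ (a ∷ x) < ℓ x →
              P x (a ∷ v) ≗P ((P (a ∷ x) v ⊕ shift 1 (P x v)) ⊖ Σz)) ×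
           (ℓ x < ℓ (a ∷ x) →
              P x (a ∷ v) ≗P ((shift 1 (P (a ∷ x) v) ⊕ P x v) ⊖ Σz))

{-# OPTIONS --safe #-}

-- W acts simply transitively on the alcoves, which we describe by integer coordinates
-- (i, j, k) with i + j + k ∈ {0, 1}.  Length is |i| + |j| + |k|, a generator is a left
-- descent iff its coordinate is positive, and c₁ ∪ {e} consists of the elements with a
-- vanishing coordinate.  For every w in c₁ one has P_{x,w} ∈ {0, 1, 1 + q}, so that
-- μ(u,w) = 0 as soon as l(w) - l(u) ≥ 5.  The bound on the degree comes from closed
-- formulas: the sets of x for which P_{x,w} has constant term 1, respectively linear
-- term q, are convex regions (or unions of two) cut out by linear inequalities.  The
-- Kazhdan–Lusztig recursion for w in c₁ only involves c₁ and two further families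
-- next to it, for which there are similar formulas, and it becomes a list of
-- identities between indicator functions of such regions.

module Submission where

-- The correction terms of the recursion are what force the two further families. With C the
-- Kazhdan-Lusztig basis and a the multiplying generator, the relations behind the steps are, up to
-- symmetry, C_a C_E(m) = C_O(m+1) + C_U(m-1) + C_U(m-2) and C_a C_O(m) = C_E(m) + C_V(m-2), and for
-- another ascending generator C_a C_E(m) = C_U(m) + C_U(m-1) + C_O(m) and C_a C_O(m) = C_V(m-1) +
-- C_E(m-1), with fewer terms at low levels. No term leaves the four families, so an induction on m
-- closes. The term U(m-2) is shorter than E(m) by 3 and has μ = 1: the bound 5 cannot be lowered to
-- 3. The obstacle is the sum over a Bruhat interval, since the order is never computed. For
-- polynomials of degree at most 1, μ(z,v) can be nonzero only if z is shorter than v by 1 or 3, so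
-- the candidates z are found from inequalities between coordinates and lengths; Bruhat relations
-- are proved only for the few survivors, by explicit reflections. The regions themselves are not
-- derived from the order either: the recursion propagates them from P_{x,e}.

open import Defs
open import Data.Nat as ℕ using (ℕ; zero; suc; z≤n; s≤s; _∸_; ⌊_/2⌋)
import Data.Nat.Properties as ℕₚ
open import Data.Nat.Tactic.RingSolver using () renaming (solve-∀ to solve-∀ℕ)
open import Data.Integer as ℤ using (ℤ; 0ℤ; 1ℤ; +_; +[1+_]; +0; -[1+_]; _+_; _-_; -_; _*_; _≤_; _≤ᵇ_; ∣_∣; +≤+; -≤+)
import Data.Integer.Properties as ℤₚ
open import Data.Integer.Tactic.RingSolver using (solve-∀)
open import Data.Bool using (Bool; true; false; not; _∧_; _∨_; T; if_then_else_)
open import Data.Bool.Properties using (T?; T-∧; T-∨; T-≡; ¬-not; not-injective; ∧-conicalˡ; ∧-conicalʳ; ∨-conicalˡ; ∨-conicalʳ)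
open import Data.Unit using (tt)
open import Data.Empty using (⊥; ⊥-elim)
open import Data.Product using (Σ; ∃; _×_; _,_; proj₁; proj₂)
open import Data.Sum using (_⊎_; inj₁; inj₂)
open import Data.Fin using (Fin; zero; suc)
open import Data.Vec as Vec using (Vec; []; _∷_; lookup; zipWith)
open import Data.List using (List; []; _∷_; _++_; length; reverse; foldr; map; concatMap; filter; cartesianProductWith)
open import Data.List.Properties using (++-assoc; unfold-reverse; reverse-++; reverse-involutive)
open import Data.List.Membership.Propositional using (_∈_)
open import Data.List.Membership.Propositional.Properties using (∈-cartesianProductWith⁺)
open import Data.List.Relation.Unary.Any as Any using (Any; here; there; any?)
open import Data.List.Relation.Unary.All as All using (All; []; _∷_)
open import Data.List.Relation.Unary.All.Properties using (++⁺; concat⁺; map⁺; filter⁺; ¬Any⇒All¬)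
open import Data.List.Relation.Unary.AllPairs using (AllPairs; []; _∷_)
open import Function using (_∘_; Equivalence)
open import Relation.Nullary using (¬_; yes; no; Dec; does)
open import Relation.Nullary.Decidable using (map′; _×-dec_; decidable-stable)
open import Relation.Binary.PropositionalEquality using (_≡_; _≢_; refl; sym; trans; cong; cong₂; subst; module ≡-Reasoning)

-- Quantifier-free linear integer arithmetic, decided by Fourier–Motzkin elimination

private variable n : ℕ

infixl 6 _⊹_ _⊝_
infix 5 _≤′_ _≐′_
infix 4 _⊨_
infixr 4 _∧′_
infixr 3 _∨′_
infixr 2 _⇒′_ _⇔′_

data Exp (n : ℕ) : Set where
  var     : Fin n → Exp n
  con     : ℤ → Exp n
  neg     : Exp n → Exp n
  _⊹_ _⊝_ : Exp n → Exp n → Exp n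

data Form (n : ℕ) : Set where
  _≤′_           : Exp n → Exp n → Form n
  _∧′_ _∨′_ _⇒′_ : Form n → Form n → Form n

_⇔′_ : Form n → Form n → Form n
f ⇔′ g = (f ⇒′ g) ∧′ (g ⇒′ f)

_≐′_ : Exp n → Exp n → Form n
d ≐′ e = (d ≤′ e) ∧′ (e ≤′ d)

⊥′ : Form n
⊥′ = con 1ℤ ≤′ con 0ℤ

⟦_⟧ : Exp n → Vec ℤ n → ℤ
⟦ var i ⟧ ρ = lookup ρ i
⟦ con c ⟧ ρ = c
⟦ neg e ⟧ ρ = - ⟦ e ⟧ ρ
⟦ d ⊹ e ⟧ ρ = ⟦ d ⟧ ρ + ⟦ e ⟧ ρ
⟦ d ⊝ e ⟧ ρ = ⟦ d ⟧ ρ - ⟦ e ⟧ ρ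

-- Two semantics are kept side by side: the Boolean one supplies the indicator functions that occur
-- as coefficients, the propositional one `⊨` is the form in which `solve` takes hypotheses and
-- returns conclusions.
ev : Form n → Vec ℤ n → Bool
ev (d ≤′ e) ρ = ⟦ d ⟧ ρ ≤ᵇ ⟦ e ⟧ ρ
ev (f ∧′ g) ρ = ev f ρ ∧ ev g ρ
ev (f ∨′ g) ρ = ev f ρ ∨ ev g ρ
ev (f ⇒′ g) ρ = not (ev f ρ) ∨ ev g ρ

_⊨_ : Vec ℤ n → Form n → Set
ρ ⊨ (d ≤′ e) = ⟦ d ⟧ ρ ≤ ⟦ e ⟧ ρ
ρ ⊨ (f ∧′ g) = ρ ⊨ f × ρ ⊨ g
ρ ⊨ (f ∨′ g) = ρ ⊨ f ⊎ ρ ⊨ g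
ρ ⊨ (f ⇒′ g) = ρ ⊨ f → ρ ⊨ g

ev-complete : ∀ f {ρ : Vec ℤ n} → ρ ⊨ f → T (ev f ρ)
ev-sound    : ∀ f {ρ : Vec ℤ n} → T (ev f ρ) → ρ ⊨ f
ev-complete (d ≤′ e) h        = ℤₚ.≤⇒≤ᵇ h
ev-complete (f ∧′ g) (h , h′) = Equivalence.from T-∧ (ev-complete f h , ev-complete g h′)
ev-complete (f ∨′ g) (inj₁ h) = Equivalence.from T-∨ (inj₁ (ev-complete f h))
ev-complete (f ∨′ g) {ρ} (inj₂ h) = Equivalence.from (T-∨ {ev f ρ}) (inj₂ (ev-complete g h))
ev-complete (f ⇒′ g) {ρ} h with ev f ρ in eq
... | true  = ev-complete g (h (ev-sound f (subst T (sym eq) tt)))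
... | false = tt
ev-sound (d ≤′ e)     τ = ℤₚ.≤ᵇ⇒≤ τ
ev-sound (f ∧′ g) {ρ} τ with Equivalence.to (T-∧ {ev f ρ}) τ
... | u , u′ = ev-sound f u , ev-sound g u′
ev-sound (f ∨′ g) {ρ} τ with Equivalence.to (T-∨ {ev f ρ}) τ
... | inj₁ u = inj₁ (ev-sound f u)
... | inj₂ u = inj₂ (ev-sound g u)
ev-sound (f ⇒′ g) {ρ} τ h with ev f ρ | ev-complete f {ρ} h
... | true | _ = ev-sound g τ

-- Coefficients followed by the constant term.
Lin : ℕ → Set
Lin n = Vec ℤ (suc n)

val : Lin n → Vec ℤ n → ℤ
val {zero}  (c ∷ []) []      = c
val {suc n} (a ∷ as) (x ∷ ρ) = a * x + val as ρ

_⊞_ _⊟_ : Lin n → Lin n → Lin n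
_⊞_ = zipWith _+_
_⊟_ = zipWith _-_

_⊡_ : ℤ → Lin n → Lin n
k ⊡ p = Vec.map (k *_) p

constant : ∀ n → ℤ → Lin n
constant zero    c = c ∷ []
constant (suc n) c = 0ℤ ∷ constant n c

unit : Fin n → Lin n
unit {suc n} zero    = 1ℤ ∷ constant n 0ℤ
unit {suc n} (suc i) = 0ℤ ∷ unit i

linear : Exp n → Lin n
linear (var i) = unit i
linear (con c) = constant _ c
linear (neg e) = -[1+ 0 ] ⊡ linear e
linear (d ⊹ e) = linear d ⊞ linear e
linear (d ⊝ e) = linear d ⊟ linear e

val-⊞ : (p q : Lin n) (ρ : Vec ℤ n) → val (p ⊞ q) ρ ≡ val p ρ + val q ρ
val-⊞ (c ∷ []) (d ∷ []) []      = refl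
val-⊞ (a ∷ p)  (b ∷ q)  (x ∷ ρ) rewrite val-⊞ p q ρ = lem a b x (val p ρ) (val q ρ)
  where lem : ∀ a b x u v → (a + b) * x + (u + v) ≡ a * x + u + (b * x + v)
        lem = solve-∀

val-⊟ : (p q : Lin n) (ρ : Vec ℤ n) → val (p ⊟ q) ρ ≡ val p ρ - val q ρ
val-⊟ (c ∷ []) (d ∷ []) []      = refl
val-⊟ (a ∷ p)  (b ∷ q)  (x ∷ ρ) rewrite val-⊟ p q ρ = lem a b x (val p ρ) (val q ρ)
  where lem : ∀ a b x u v → (a - b) * x + (u - v) ≡ a * x + u - (b * x + v)
        lem = solve-∀

val-⊡ : ∀ k (p : Lin n) (ρ : Vec ℤ n) → val (k ⊡ p) ρ ≡ k * val p ρ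
val-⊡ k (c ∷ []) []      = refl
val-⊡ k (a ∷ p)  (x ∷ ρ) rewrite val-⊡ k p ρ = lem k a x (val p ρ)
  where lem : ∀ k a x u → k * a * x + k * u ≡ k * (a * x + u)
        lem = solve-∀

val-constant : ∀ c (ρ : Vec ℤ n) → val (constant n c) ρ ≡ c
val-constant c []      = refl
val-constant c (x ∷ ρ) = trans (ℤₚ.+-identityˡ _) (val-constant c ρ)

val-unit : ∀ i (ρ : Vec ℤ n) → val (unit i) ρ ≡ lookup ρ i
val-unit zero    (x ∷ ρ) rewrite val-constant 0ℤ ρ =
  trans (ℤₚ.+-identityʳ _) (ℤₚ.*-identityˡ x)
val-unit (suc i) (x ∷ ρ) = trans (ℤₚ.+-identityˡ _) (val-unit i ρ)

val-linear : ∀ e (ρ : Vec ℤ n) → val (linear e) ρ ≡ ⟦ e ⟧ ρ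
val-linear (var i) ρ = val-unit i ρ
val-linear (con c) ρ = val-constant c ρ
val-linear (neg e) ρ = trans (val-⊡ -[1+ 0 ] (linear e) ρ)
  (trans (ℤₚ.-1*i≡-i _) (cong -_ (val-linear e ρ)))
val-linear (d ⊹ e) ρ = trans (val-⊞ (linear d) (linear e) ρ) (cong₂ _+_ (val-linear d ρ) (val-linear e ρ))
val-linear (d ⊝ e) ρ = trans (val-⊟ (linear d) (linear e) ρ) (cong₂ _-_ (val-linear d ρ) (val-linear e ρ))

Holds : Vec ℤ n → Lin n → Set
Holds ρ p = 0ℤ ≤ val p ρ

positiveHead negativeHead : Lin (suc n) → Bool
positiveHead (+[1+ _ ] ∷ _) = true
positiveHead _              = false
negativeHead (-[1+ _ ] ∷ _) = true
negativeHead _              = false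

headFree : Lin (suc n) → List (Lin n)
headFree (+0 ∷ p) = p ∷ []
headFree _        = []

resolve : Lin (suc n) → Lin (suc n) → List (Lin n)
resolve (+[1+ a ] ∷ p) (-[1+ b ] ∷ q) = ((+[1+ b ] ⊡ p) ⊞ (+[1+ a ] ⊡ q)) ∷ []
resolve _              _              = []

-- Discarding the constraints 0 ≤ c with c ≥ 0 keeps the elimination small.
informative : Lin n → Bool
informative (+ _      ∷ [])    = false
informative (-[1+ _ ] ∷ [])    = true
informative (+0       ∷ x ∷ p) = informative (x ∷ p)
informative (_        ∷ x ∷ p) = true

eliminate : List (Lin (suc n)) → List (Lin n)
eliminate cs = filter (T? ∘ informative)
  (concatMap headFree cs ++
   concatMap (λ p → concatMap (resolve p) (filter (T? ∘ negativeHead) cs))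
             (filter (T? ∘ positiveHead) cs))

absurd : List (Lin zero) → Bool
absurd []                     = false
absurd ((-[1+ _ ] ∷ []) ∷ cs) = true
absurd ((+ _      ∷ []) ∷ cs) = absurd cs

-- The elimination is the rational one, and only its soundness is proved. Integrality enters solely
-- in `refute`, where the negation of d ≤ e becomes d - e - 1 ≥ 0.
fourierMotzkin : List (Lin n) → Bool
fourierMotzkin {zero}  cs = absurd cs
fourierMotzkin {suc n} cs = fourierMotzkin (eliminate cs)

headFree-sound : ∀ x (ρ : Vec ℤ n) p → Holds (x ∷ ρ) p → All (Holds ρ) (headFree p)
headFree-sound x ρ (+0       ∷ p) h = subst (0ℤ ≤_) (ℤₚ.+-identityˡ _) h ∷ []
headFree-sound x ρ (+[1+ _ ] ∷ p) h = []
headFree-sound x ρ (-[1+ _ ] ∷ p) h = []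

resolve-sound : ∀ x (ρ : Vec ℤ n) p q → Holds (x ∷ ρ) p → Holds (x ∷ ρ) q →
                All (Holds ρ) (resolve p q)
resolve-sound x ρ (+[1+ a ] ∷ p) (-[1+ b ] ∷ q) hp hq = subst (0ℤ ≤_) eq pos ∷ []
  where
  A = +[1+ a ]
  B = +[1+ b ]
  nonneg : ∀ k {u} → 0ℤ ≤ u → 0ℤ ≤ +[1+ k ] * u
  nonneg k {u} h = subst (_≤ +[1+ k ] * u) (ℤₚ.*-zeroʳ +[1+ k ]) (ℤₚ.*-monoˡ-≤-nonNeg +[1+ k ] h)
  pos : 0ℤ ≤ B * (A * x + val p ρ) + A * (- B * x + val q ρ)
  pos = ℤₚ.+-mono-≤ (nonneg b hp) (nonneg a hq)
  lem : ∀ A B x u v → B * (A * x + u) + A * (- B * x + v) ≡ B * u + A * v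
  lem = solve-∀
  eq : B * (A * x + val p ρ) + A * (- B * x + val q ρ) ≡ val ((B ⊡ p) ⊞ (A ⊡ q)) ρ
  eq rewrite val-⊞ (B ⊡ p) (A ⊡ q) ρ | val-⊡ B p ρ | val-⊡ A q ρ = lem A B x (val p ρ) (val q ρ)
resolve-sound x ρ (+0       ∷ p) q              hp hq = []
resolve-sound x ρ (-[1+ _ ] ∷ p) q              hp hq = []
resolve-sound x ρ (+[1+ _ ] ∷ p) (+ _ ∷ q)      hp hq = []

concatMap⁺ : ∀ {A B : Set} {Q : B → Set} {f : A → List B} {xs} →
             All (All Q ∘ f) xs → All Q (concatMap f xs)
concatMap⁺ = concat⁺ ∘ map⁺

eliminate-sound : ∀ x (ρ : Vec ℤ n) cs → All (Holds (x ∷ ρ)) cs → All (Holds ρ) (eliminate cs)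
eliminate-sound x ρ cs h = filter⁺ (T? ∘ informative) (++⁺
  (concatMap⁺ (All.map (headFree-sound x ρ _) h))
  (concatMap⁺ (All.map (λ hp → concatMap⁺ (All.map (resolve-sound x ρ _ _ hp)
      (filter⁺ (T? ∘ negativeHead) h)))
    (filter⁺ (T? ∘ positiveHead) h))))

absurd-sound : ∀ cs → T (absurd cs) → All (Holds []) cs → ⊥
absurd-sound ((-[1+ _ ] ∷ []) ∷ cs) τ (() ∷ h)
absurd-sound ((+ _      ∷ []) ∷ cs) τ (_  ∷ h) = absurd-sound cs τ h

fourierMotzkin-sound : (ρ : Vec ℤ n) → ∀ cs → T (fourierMotzkin cs) → All (Holds ρ) cs → ⊥
fourierMotzkin-sound []      cs τ h = absurd-sound cs τ h
fourierMotzkin-sound (x ∷ ρ) cs τ h =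
  fourierMotzkin-sound ρ (eliminate cs) τ (eliminate-sound x ρ cs h)

-- refute b f k cs: every way of giving f the truth value b, added to cs, is
-- contradictory according to k.
refute : Bool → Form n → (List (Lin n) → Bool) → List (Lin n) → Bool
split  : Bool → Form n → Bool → Form n → (List (Lin n) → Bool) → List (Lin n) → Bool
refute true  (d ≤′ e) k cs = k (linear (e ⊝ d) ∷ cs)
refute false (d ≤′ e) k cs = k (linear ((d ⊝ e) ⊝ con 1ℤ) ∷ cs)
refute true  (f ∧′ g) k cs = refute true f (refute true g k) cs
refute false (f ∧′ g) k cs = split false f false g k cs
refute true  (f ∨′ g) k cs = split true f true g k cs
refute false (f ∨′ g) k cs = refute false f (refute false g k) cs
refute true  (f ⇒′ g) k cs = split false f true g k cs
refute false (f ⇒′ g) k cs = refute true f (refute false g k) cs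
-- Testing the constraints collected so far before branching prunes the case tree.
split b f c g k cs = fourierMotzkin cs ∨ (refute b f k cs ∧ refute c g k cs)

valid : Form n → Bool
valid f = refute false f fourierMotzkin []

module _ (ρ : Vec ℤ n) where

  Refutes : (List (Lin n) → Bool) → Set
  Refutes k = ∀ cs → T (k cs) → All (Holds ρ) cs → ⊥

  ≤-holds : ∀ d e → ev (d ≤′ e) ρ ≡ true → Holds ρ (linear (e ⊝ d))
  ≤-holds d e eq = subst (0ℤ ≤_) (sym (val-linear (e ⊝ d) ρ))
    (ℤₚ.i≤j⇒0≤j-i {⟦ d ⟧ ρ} {⟦ e ⟧ ρ} (ℤₚ.≤ᵇ⇒≤ (subst T (sym eq) tt)))

  >-holds : ∀ d e → ev (d ≤′ e) ρ ≡ false → Holds ρ (linear ((d ⊝ e) ⊝ con 1ℤ))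
  >-holds d e eq = subst (0ℤ ≤_) (sym (val-linear ((d ⊝ e) ⊝ con 1ℤ) ρ))
    (subst (0ℤ ≤_) (lem (⟦ d ⟧ ρ) (⟦ e ⟧ ρ))
      (ℤₚ.i≤j⇒0≤j-i {1ℤ + ⟦ e ⟧ ρ} {⟦ d ⟧ ρ}
        (ℤₚ.i<j⇒suc[i]≤j (ℤₚ.≰⇒> {⟦ d ⟧ ρ} λ d≤e → subst T eq (ℤₚ.≤⇒≤ᵇ d≤e)))))
    where lem : ∀ x y → x - (1ℤ + y) ≡ x - y - 1ℤ
          lem = solve-∀

  refute-sound : ∀ b f {k} → Refutes k → ∀ cs → T (refute b f k cs) →
                 All (Holds ρ) cs → ev f ρ ≡ b → ⊥
  split-sound  : ∀ b f c g {k} → Refutes k → ∀ cs → T (split b f c g k cs) →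
                 All (Holds ρ) cs → ev f ρ ≡ b ⊎ ev g ρ ≡ c → ⊥
  refute-sound true  (d ≤′ e) K cs τ h eq = K _ τ (≤-holds d e eq ∷ h)
  refute-sound false (d ≤′ e) K cs τ h eq = K _ τ (>-holds d e eq ∷ h)
  refute-sound true  (f ∧′ g) K cs τ h eq = refute-sound true f
    (λ cs′ τ′ h′ → refute-sound true g K cs′ τ′ h′ (∧-conicalʳ _ _ eq)) cs τ h (∧-conicalˡ _ _ eq)
  refute-sound false (f ∧′ g) K cs τ h eq = split-sound false f false g K cs τ h (∧-false (ev f ρ) eq)
    where ∧-false : ∀ x {y} → x ∧ y ≡ false → x ≡ false ⊎ y ≡ false
          ∧-false false _ = inj₁ refl
          ∧-false true  p = inj₂ p
  refute-sound true  (f ∨′ g) K cs τ h eq = split-sound true f true g K cs τ h (∨-true (ev f ρ) eq)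
    where ∨-true : ∀ x {y} → x ∨ y ≡ true → x ≡ true ⊎ y ≡ true
          ∨-true true  _ = inj₁ refl
          ∨-true false p = inj₂ p
  refute-sound false (f ∨′ g) K cs τ h eq = refute-sound false f
    (λ cs′ τ′ h′ → refute-sound false g K cs′ τ′ h′ (∨-conicalʳ _ _ eq)) cs τ h (∨-conicalˡ _ _ eq)
  refute-sound true  (f ⇒′ g) K cs τ h eq = split-sound false f true g K cs τ h (⇒-true (ev f ρ) eq)
    where ⇒-true : ∀ x {y} → not x ∨ y ≡ true → x ≡ false ⊎ y ≡ true
          ⇒-true false _ = inj₁ refl
          ⇒-true true  p = inj₂ p
  refute-sound false (f ⇒′ g) K cs τ h eq = refute-sound true f
    (λ cs′ τ′ h′ → refute-sound false g K cs′ τ′ h′ (∨-conicalʳ (not (ev f ρ)) _ eq)) cs τ h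
    (not-injective (∨-conicalˡ _ _ eq))
  split-sound b f c g {k} K cs τ h eq with Equivalence.to (T-∨ {fourierMotzkin cs}) τ
  ... | inj₁ u = fourierMotzkin-sound ρ cs u h
  ... | inj₂ u with Equivalence.to (T-∧ {refute b f k cs}) u | eq
  ...   | uf , ug | inj₁ e = refute-sound b f K cs uf h e
  ...   | uf , ug | inj₂ e = refute-sound c g K cs ug h e

decide : (f : Form n) → valid f ≡ true → ∀ ρ → T (ev f ρ)
decide f v ρ with ev f ρ in eq
... | true  = tt
... | false = refute-sound ρ false f (fourierMotzkin-sound ρ) [] (subst T (sym v) tt) [] eq

solve : (f : Form n) → valid f ≡ true → ∀ ρ → ρ ⊨ f
solve f v ρ = ev-sound f (decide f v ρ)

≐-elim : ∀ {x y : ℤ} → x ≤ y × y ≤ x → x ≡ y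
≐-elim (p , q) = ℤₚ.≤-antisym p q

ev-cong : ∀ f g {ρ : Vec ℤ n} → ρ ⊨ (f ⇔′ g) → ev f ρ ≡ ev g ρ
ev-cong f g {ρ} (p , q) with ev f ρ in x | ev g ρ in y
... | true  | true  = refl
... | false | false = refl
... | true  | false = ⊥-elim (subst T y (ev-complete g (p (ev-sound f (subst T (sym x) tt)))))
... | false | true  = ⊥-elim (subst T x (ev-complete f (q (ev-sound g (subst T (sym y) tt)))))

-- Alcoves

-- The alcove with coordinates (i, j, k) lies between the hyperplanes numbered
-- i, j, k in the three directions of roots; i + j + k is 0 or 1 according to its
-- orientation, and (0, 0, 0) is the fundamental alcove.
record Alcove : Set where
  constructor alc
  field i j k : ℤ

infix 9 _!_
_!_ : Alcove → Gen → ℤ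
alc i j k ! r = i
alc i j k ! s = j
alc i j k ! t = k

act : Gen → Alcove → Alcove
act r (alc i j k) = alc (1ℤ - i) (- k) (- j)
act s (alc i j k) = alc (- k) (1ℤ - j) (- i)
act t (alc i j k) = alc (- j) (- i) (1ℤ - k)

origin : Alcove
origin = alc 0ℤ 0ℤ 0ℤ

acts : Word → Alcove → Alcove
acts []      p = p
acts (a ∷ w) p = act a (acts w p)

alcove : Word → Alcove
alcove w = acts w origin

total : Alcove → ℤ
total (alc i j k) = i + j + k

size : Alcove → ℕ
size (alc i j k) = ∣ i ∣ ℕ.+ ∣ j ∣ ℕ.+ ∣ k ∣

alc-≡ : ∀ {i j k i′ j′ k′} → i ≡ i′ → j ≡ j′ → k ≡ k′ → alc i j k ≡ alc i′ j′ k′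
alc-≡ refl refl refl = refl

-- The six orderings of the generators, that is, the symmetries of the Coxeter diagram: a statement
-- proved for an arbitrary frame covers all its rotated and mirrored versions.
data Frame : Gen → Gen → Gen → Set where
  rst : Frame r s t
  str : Frame s t r
  trs : Frame t r s
  rts : Frame r t s
  tsr : Frame t s r
  srt : Frame s r t

rotate : ∀ {a b c} → Frame a b c → Frame b c a
rotate rst = str
rotate str = trs
rotate trs = rst
rotate rts = tsr
rotate tsr = srt
rotate srt = rts

swap : ∀ {a b c} → Frame a b c → Frame a c b
swap rst = rts
swap str = srt
swap trs = tsr
swap rts = rst
swap tsr = trs
swap srt = str

frame : ∀ a b → a ≢ b → ∃ λ c → Frame a b c
frame r r ne = ⊥-elim (ne refl)
frame r s ne = t , rst
frame r t ne = s , rts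
frame s r ne = t , srt
frame s s ne = ⊥-elim (ne refl)
frame s t ne = r , str
frame t r ne = s , trs
frame t s ne = r , tsr
frame t t ne = ⊥-elim (ne refl)

_≟_ : (a b : Gen) → Dec (a ≡ b)
r ≟ r = yes refl
r ≟ s = no λ ()
r ≟ t = no λ ()
s ≟ r = no λ ()
s ≟ s = yes refl
s ≟ t = no λ ()
t ≟ r = no λ ()
t ≟ s = no λ ()
t ≟ t = yes refl

alcove-ext : ∀ {a b c} → Frame a b c → ∀ {p q} → p ! a ≡ q ! a → p ! b ≡ q ! b → p ! c ≡ q ! c → p ≡ q
alcove-ext rst x y z = alc-≡ x y z
alcove-ext str x y z = alc-≡ z x y
alcove-ext trs x y z = alc-≡ y z x
alcove-ext rts x y z = alc-≡ x z y
alcove-ext tsr x y z = alc-≡ z y x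
alcove-ext srt x y z = alc-≡ y x z

act-here : ∀ a p → act a p ! a ≡ 1ℤ - p ! a
act-here r p = refl
act-here s p = refl
act-here t p = refl

act-there : ∀ {a b c} → Frame a b c → ∀ p → act a p ! b ≡ - p ! c
act-there rst p = refl
act-there str p = refl
act-there trs p = refl
act-there rts p = refl
act-there tsr p = refl
act-there srt p = refl

total-frame : ∀ {a b c} → Frame a b c → ∀ p → total p ≡ p ! a + p ! b + p ! c
total-frame rst p = refl
total-frame str (alc i j k) = lem i j k
  where lem : ∀ i j k → i + j + k ≡ j + k + i
        lem = solve-∀
total-frame trs (alc i j k) = lem i j k
  where lem : ∀ i j k → i + j + k ≡ k + i + j
        lem = solve-∀
total-frame rts (alc i j k) = lem i j k
  where lem : ∀ i j k → i + j + k ≡ i + k + j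
        lem = solve-∀
total-frame tsr (alc i j k) = lem i j k
  where lem : ∀ i j k → i + j + k ≡ k + j + i
        lem = solve-∀
total-frame srt (alc i j k) = lem i j k
  where lem : ∀ i j k → i + j + k ≡ j + i + k
        lem = solve-∀

size-frame : ∀ {a b c} → Frame a b c → ∀ p → size p ≡ ∣ p ! a ∣ ℕ.+ ∣ p ! b ∣ ℕ.+ ∣ p ! c ∣
size-frame rst p = refl
size-frame srt (alc i j k) = cong (ℕ._+ ∣ k ∣) (ℕₚ.+-comm ∣ i ∣ ∣ j ∣)
size-frame str (alc i j k) = trans (ℕₚ.+-assoc ∣ i ∣ _ _) (ℕₚ.+-comm ∣ i ∣ _)
size-frame trs (alc i j k) = trans (ℕₚ.+-comm _ ∣ k ∣) (sym (ℕₚ.+-assoc ∣ k ∣ _ _))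
size-frame rts (alc i j k) = trans (ℕₚ.+-assoc ∣ i ∣ _ _)
  (trans (cong (∣ i ∣ ℕ.+_) (ℕₚ.+-comm ∣ j ∣ _)) (sym (ℕₚ.+-assoc ∣ i ∣ _ _)))
size-frame tsr p@(alc i j k) = trans (size-frame srt p)
  (trans (ℕₚ.+-comm _ ∣ k ∣) (sym (ℕₚ.+-assoc ∣ k ∣ _ _)))

anyFrame : ∀ a → ∃ λ b → ∃ λ c → Frame a b c
anyFrame r = _ , _ , rst
anyFrame s = _ , _ , str
anyFrame t = _ , _ , trs

act-involutive : ∀ a p → act a (act a p) ≡ p
act-involutive a p with anyFrame a
... | b , c , F = alcove-ext F
  (trans (act-here a _) (trans (cong (_-_ 1ℤ) (act-here a p)) (lem (p ! a))))
  (trans (act-there F _) (trans (cong -_ (act-there (swap F) p)) (ℤₚ.neg-involutive _)))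
  (trans (act-there (swap F) _) (trans (cong -_ (act-there F p)) (ℤₚ.neg-involutive _)))
  where lem : ∀ x → 1ℤ - (1ℤ - x) ≡ x
        lem = solve-∀

act-braid : ∀ {a b c} → Frame a b c → ∀ p → act a (act b (act a p)) ≡ act b (act a (act b p))
act-braid F (alc i j k) = cases F
  where
  L : ∀ x → 1ℤ - - - x ≡ - - (1ℤ - x)
  L = solve-∀
  cases : ∀ {a b c} → Frame a b c →
          act a (act b (act a (alc i j k))) ≡ act b (act a (act b (alc i j k)))
  cases rst = alc-≡ (L j) (sym (L i)) refl
  cases str = alc-≡ refl (L k) (sym (L j))
  cases trs = alc-≡ (sym (L k)) refl (L i)
  cases rts = alc-≡ (L k) refl (sym (L i))
  cases tsr = alc-≡ refl (sym (L k)) (L j)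
  cases srt = alc-≡ (sym (L j)) (L i) refl

acts-++ : ∀ u v p → acts (u ++ v) p ≡ acts u (acts v p)
acts-++ []      v p = refl
acts-++ (a ∷ u) v p = cong (act a) (acts-++ u v p)

act-order-3 : ∀ a b p → act a (act b (act a (act b (act a (act b p))))) ≡ p
act-order-3 a b p with a ≟ b
... | yes refl = trans (act-involutive a _) (trans (act-involutive a _) (act-involutive a p))
... | no a≢b with frame a b a≢b
...   | c , F = trans (cong (act a ∘ act b ∘ act a) (sym (act-braid F p)))
  (trans (cong (act a ∘ act b) (act-involutive a _))
    (trans (cong (act a) (act-involutive b _)) (act-involutive a p)))

acts-~ : ∀ {v w} → v ~ w → ∀ p → acts v p ≡ acts w p
acts-~ ~-refl             p = refl
acts-~ (~-sym h)          p = sym (acts-~ h p)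
acts-~ (~-trans h h′)     p = trans (acts-~ h p) (acts-~ h′ p)
acts-~ (~-sq xs a ys)     p = trans (acts-++ xs _ p)
  (trans (cong (acts xs) (act-involutive a (acts ys p))) (sym (acts-++ xs ys p)))
acts-~ (~-br xs a b ys)   p = trans (acts-++ xs _ p)
  (trans (cong (acts xs) (act-order-3 a b (acts ys p))) (sym (acts-++ xs ys p)))

alcove-~ : ∀ {v w} → v ~ w → alcove v ≡ alcove w
alcove-~ h = acts-~ h origin

Oriented : Alcove → Set
Oriented p = total p ≡ 0ℤ ⊎ total p ≡ 1ℤ

total-act : ∀ a p → total (act a p) ≡ 1ℤ - total p
total-act r (alc i j k) = lem i j k
  where lem : ∀ i j k → 1ℤ - i + - k + - j ≡ 1ℤ - (i + j + k)
        lem = solve-∀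
total-act s (alc i j k) = lem i j k
  where lem : ∀ i j k → - k + (1ℤ - j) + - i ≡ 1ℤ - (i + j + k)
        lem = solve-∀
total-act t (alc i j k) = lem i j k
  where lem : ∀ i j k → - j + - i + (1ℤ - k) ≡ 1ℤ - (i + j + k)
        lem = solve-∀

act-oriented : ∀ a {p} → Oriented p → Oriented (act a p)
act-oriented a {p} (inj₁ h) = inj₂ (trans (total-act a p) (cong (_-_ 1ℤ) h))
act-oriented a {p} (inj₂ h) = inj₁ (trans (total-act a p) (cong (_-_ 1ℤ) h))

alcove-oriented : ∀ w → Oriented (alcove w)
alcove-oriented []      = inj₁ refl
alcove-oriented (a ∷ w) = act-oriented a (alcove-oriented w)

abs-1- : ∀ i → i ≤ 0ℤ → ∣ 1ℤ - i ∣ ≡ suc ∣ i ∣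
abs-1- +0       _ = refl
abs-1- -[1+ n ] _ = refl
abs-1- +[1+ n ] (+≤+ ())

-- The other two coordinates are only exchanged and negated, so the change of length comes from i ↦
-- 1 - i alone.
size-up : ∀ a p → p ! a ≤ 0ℤ → size (act a p) ≡ suc (size p)
size-up a p h with anyFrame a
... | b , c , F = begin
  size (act a p)                                              ≡⟨ size-frame F (act a p) ⟩
  ∣ act a p ! a ∣ ℕ.+ ∣ act a p ! b ∣ ℕ.+ ∣ act a p ! c ∣     ≡⟨ cong₂ ℕ._+_ (cong₂ ℕ._+_
      (trans (cong ∣_∣ (act-here a p)) (abs-1- (p ! a) h))
      (trans (cong ∣_∣ (act-there F p)) (ℤₚ.∣-i∣≡∣i∣ (p ! c))))
      (trans (cong ∣_∣ (act-there (swap F) p)) (ℤₚ.∣-i∣≡∣i∣ (p ! b))) ⟩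
  suc (∣ p ! a ∣ ℕ.+ ∣ p ! c ∣ ℕ.+ ∣ p ! b ∣)                 ≡⟨ cong suc (sym (size-frame (swap F) p)) ⟩
  suc (size p)                                                ∎
  where open ≡-Reasoning

act-≤0 : ∀ a p → 1ℤ ≤ p ! a → act a p ! a ≤ 0ℤ
act-≤0 a p h = subst (_≤ 0ℤ) (sym (act-here a p)) (ℤₚ.i≤j⇒i-j≤0 h)

act-≥1 : ∀ a p → p ! a ≤ 0ℤ → 1ℤ ≤ act a p ! a
act-≥1 a p h = subst (1ℤ ≤_) (sym (act-here a p)) (ℤₚ.+-monoʳ-≤ 1ℤ (ℤₚ.neg-mono-≤ h))

size-down : ∀ a p → 1ℤ ≤ p ! a → suc (size (act a p)) ≡ size p
size-down a p h = trans (sym (size-up a (act a p) (act-≤0 a p h))) (cong size (act-involutive a p))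

≤0⊎≥1 : ∀ x → x ≤ 0ℤ ⊎ 1ℤ ≤ x
≤0⊎≥1 +0       = inj₁ (+≤+ z≤n)
≤0⊎≥1 +[1+ n ] = inj₂ (+≤+ (s≤s z≤n))
≤0⊎≥1 -[1+ n ] = inj₁ -≤+

size-act-≤ : ∀ a p → size (act a p) ℕ.≤ suc (size p)
size-act-≤ a p with ≤0⊎≥1 (p ! a)
... | inj₁ h = ℕₚ.≤-reflexive (size-up a p h)
... | inj₂ h = ℕₚ.≤-trans (ℕₚ.n≤1+n _) (ℕₚ.≤-trans (ℕₚ.≤-reflexive (size-down a p h)) (ℕₚ.n≤1+n _))

size-alcove-≤ : ∀ w → size (alcove w) ℕ.≤ length w
size-alcove-≤ []      = z≤n
size-alcove-≤ (a ∷ w) = ℕₚ.≤-trans (size-act-≤ a (alcove w)) (s≤s (size-alcove-≤ w))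

-- Reduced words as galleries, and faithfulness of the action

~-cons : ∀ a {v w} → v ~ w → a ∷ v ~ a ∷ w
~-cons a ~-refl           = ~-refl
~-cons a (~-sym h)        = ~-sym (~-cons a h)
~-cons a (~-trans h h′)   = ~-trans (~-cons a h) (~-cons a h′)
~-cons a (~-sq xs b ys)   = ~-sq (a ∷ xs) b ys
~-cons a (~-br xs b c ys) = ~-br (a ∷ xs) b c ys

braid-~ : ∀ a b w → a ∷ b ∷ a ∷ w ~ b ∷ a ∷ b ∷ w
braid-~ a b w = ~-trans (~-sym (~-sq (a ∷ b ∷ a ∷ []) b w))
  (~-trans (~-sym (~-sq (a ∷ b ∷ a ∷ b ∷ []) a (b ∷ w)))
    (~-trans (~-sym (~-sq (a ∷ b ∷ a ∷ b ∷ a ∷ []) b (a ∷ b ∷ w)))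
      (~-br [] a b (b ∷ a ∷ b ∷ w))))

-- A gallery from p to the fundamental alcove, each letter of which is a left descent of the alcove
-- reached so far. This makes reducedness a local condition instead of a minimum over a class of
-- words.
data Descending : Alcove → Word → Set where
  stop : Descending origin []
  down : ∀ {a p w} → 1ℤ ≤ p ! a → Descending (act a p) w → Descending p (a ∷ w)

descending-alcove : ∀ {p w} → Descending p w → alcove w ≡ p
descending-alcove stop               = refl
descending-alcove (down {a} {p} h d) = trans (cong (act a) (descending-alcove d)) (act-involutive a p)

descending-length : ∀ {p w} → Descending p w → length w ≡ size p
descending-length stop               = refl
descending-length (down {a} {p} h d) = trans (cong suc (descending-length d)) (size-down a p h)

-- The coordinates have sum at least 0, so if none is positive they all vanish.
some-positive : ∀ p → Oriented p → size p ≢ 0 → ∃ λ a → 1ℤ ≤ p ! a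
some-positive (alc i j k) o ne with ≤0⊎≥1 i | ≤0⊎≥1 j | ≤0⊎≥1 k
... | inj₂ h | _      | _      = r , h
... | inj₁ _ | inj₂ h | _      = s , h
... | inj₁ _ | inj₁ _ | inj₂ h = t , h
... | inj₁ x | inj₁ y | inj₁ z = ⊥-elim (ne (cong₂ ℕ._+_ (cong₂ ℕ._+_ (cong ∣_∣ i≡0) (cong ∣_∣ j≡0)) (cong ∣_∣ k≡0)))
  where
  I J K : Exp 3
  I = var zero
  J = var (suc zero)
  K = var (suc (suc zero))
  0≤total : Oriented (alc i j k) → 0ℤ ≤ i + j + k
  0≤total (inj₁ h) = ℤₚ.≤-reflexive (sym h)
  0≤total (inj₂ h) = subst (0ℤ ≤_) (sym h) (+≤+ z≤n)
  all-0 = solve ((I ≤′ con 0ℤ ∧′ J ≤′ con 0ℤ ∧′ K ≤′ con 0ℤ ∧′ con 0ℤ ≤′ I ⊹ J ⊹ K) ⇒′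
      (I ≐′ con 0ℤ ∧′ J ≐′ con 0ℤ ∧′ K ≐′ con 0ℤ)) refl (i ∷ j ∷ k ∷ []) (x , y , z , 0≤total o)
  i≡0 = ≐-elim (proj₁ all-0)
  j≡0 = ≐-elim (proj₁ (proj₂ all-0))
  k≡0 = ≐-elim (proj₂ (proj₂ all-0))

size-0 : ∀ p → size p ≡ 0 → p ≡ origin
size-0 (alc +0 +0 +0) eq = refl

descend : ∀ n p → Oriented p → size p ≡ n → ∃ (Descending p)
descend zero    p o eq = [] , subst (λ q → Descending q []) (sym (size-0 p eq)) stop
descend (suc n) p o eq with some-positive p o (λ z → ℕₚ.1+n≢0 (trans (sym eq) z))
... | a , h with descend n (act a p) (act-oriented a {p} o) (ℕₚ.suc-injective (trans (size-down a p h) eq))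
...   | w , d = a ∷ w , down h d

descending : ∀ p → Oriented p → ∃ (Descending p)
descending p o = descend (size p) p o refl

third-negative : ∀ {a b c} → Frame a b c → ∀ p → Oriented p → 1ℤ ≤ p ! a → 1ℤ ≤ p ! b → 1ℤ ≤ - p ! c
third-negative {a} {b} {c} F p o x y = bound (p ! a) (p ! b) (p ! c) x y (≤1 o)
  where
  ≤1 : Oriented p → p ! a + p ! b + p ! c ≤ 1ℤ
  ≤1 (inj₁ h) = subst (_≤ 1ℤ) (trans (sym h) (total-frame F p)) (+≤+ z≤n)
  ≤1 (inj₂ h) = ℤₚ.≤-reflexive (trans (sym (total-frame F p)) h)
  I J K : Exp 3
  I = var zero
  J = var (suc zero)
  K = var (suc (suc zero))
  bound : ∀ i j k → 1ℤ ≤ i → 1ℤ ≤ j → i + j + k ≤ 1ℤ → 1ℤ ≤ - k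
  bound i j k x y z = solve ((con 1ℤ ≤′ I ∧′ con 1ℤ ≤′ J ∧′ I ⊹ J ⊹ K ≤′ con 1ℤ) ⇒′ con 1ℤ ≤′ neg K)
    refl (i ∷ j ∷ k ∷ []) (x , y , z)

-- When a and b are both descents, the third coordinate is negative. It turns into the b-coordinate
-- with opposite sign after a is removed, and the old b-coordinate then reappears at a; hence all of
-- aba can be stripped from p.
descending-dihedral : ∀ {a b c} → Frame a b c → ∀ {p z} → Oriented p → 1ℤ ≤ p ! a → 1ℤ ≤ p ! b →
                      Descending (act a (act b (act a p))) z → Descending (act a p) (b ∷ a ∷ z)
descending-dihedral {a} {b} F {p} o x y d =
  down (subst (1ℤ ≤_) (sym (act-there F p)) (third-negative F p o x y))
    (down (subst (1ℤ ≤_) (sym at-a) y) d)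
  where
  at-a : act b (act a p) ! a ≡ p ! b
  at-a = trans (act-there (swap (rotate F)) (act a p))
    (trans (cong -_ (act-there (swap F) p)) (ℤₚ.neg-involutive _))

-- The argument of Matsumoto's theorem, by induction on length: if the first letters a and b differ,
-- both words are compared with words starting with aba and bab over a common tail z, and the braid
-- relation joins these.
descending-unique : ∀ n {p v w} → Oriented p → size p ≡ n →
                    Descending p v → Descending p w → v ~ w
descending-unique n o eq stop stop = ~-refl
descending-unique n o eq stop e@(down _ _) = ⊥-elim (ℕₚ.1+n≢0 (descending-length e))
descending-unique n o eq d@(down _ _) stop = ⊥-elim (ℕₚ.1+n≢0 (descending-length d))
descending-unique zero o eq d@(down _ _) (down _ _) = ⊥-elim (ℕₚ.1+n≢0 (trans (descending-length d) eq))
descending-unique (suc n) {p} o eq (down {a} x d) (down {b} y e) with a ≟ b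
... | yes refl = ~-cons a (descending-unique n (act-oriented a {p} o)
                   (ℕₚ.suc-injective (trans (size-down a p x) eq)) d e)
... | no a≢b with frame a b a≢b
...   | c , F with descending (act a (act b (act a p)))
                     (act-oriented a {act b (act a p)} (act-oriented b {act a p} (act-oriented a {p} o)))
...     | z , f = ~-trans (~-cons a (descending-unique n (act-oriented a {p} o)
                      (ℕₚ.suc-injective (trans (size-down a p x) eq)) d
                      (descending-dihedral F o x y f)))
   (~-trans (braid-~ a b z) (~-cons b (descending-unique n (act-oriented b {p} o)
                      (ℕₚ.suc-injective (trans (size-down b p y) eq))
                      (descending-dihedral (swap (rotate F)) o y x
                        (subst (λ q → Descending q z) (act-braid F p) f)) e)))

-- Induction on the word: an ascending first letter extends a descending word of the tail, while a
-- descending one cancels against the same letter at the front of such a word. Words with equal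
-- alcoves thus share a normal form, so the presentation captures every relation seen in the
-- geometry.
~-descending : ∀ w {v} → Descending (alcove w) v → w ~ v
~-descending []      stop = ~-refl
~-descending []      d@(down _ _) = ⊥-elim (ℕₚ.1+n≢0 (descending-length d))
~-descending (a ∷ w) {v} d with descending (alcove w) (alcove-oriented w) | ≤0⊎≥1 (alcove w ! a)
... | u , e | inj₁ x = ~-trans (~-cons a (~-descending w e))
  (descending-unique _ (alcove-oriented (a ∷ w)) refl
    (down (act-≥1 a (alcove w) x) (subst (λ q → Descending q u) (sym (act-involutive a (alcove w))) e)) d)
... | u , e | inj₂ x = ~-trans (~-cons a (~-descending w (down x d))) (~-sq [] a v)

alcove-injective : ∀ v w → alcove v ≡ alcove w → v ~ w
alcove-injective v w eq with descending (alcove v) (alcove-oriented v)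
... | u , d = ~-trans (~-descending v d)
  (~-sym (~-descending w (subst (λ q → Descending q u) eq d)))

-- Reflections and the Bruhat order

acts-reverse : ∀ w p → acts w (acts (reverse w) p) ≡ p
acts-reverse []      p = refl
acts-reverse (a ∷ w) p = begin
  act a (acts w (acts (reverse (a ∷ w)) p))      ≡⟨ cong (λ u → act a (acts w (acts u p))) (unfold-reverse a w) ⟩
  act a (acts w (acts (reverse w ++ a ∷ []) p))  ≡⟨ cong (act a ∘ acts w) (acts-++ (reverse w) _ p) ⟩
  act a (acts w (acts (reverse w) (act a p)))    ≡⟨ cong (act a) (acts-reverse w (act a p)) ⟩
  act a (act a p)                                ≡⟨ act-involutive a p ⟩
  p                                              ∎
  where open ≡-Reasoning

Reflection : (Alcove → Alcove) → Set
Reflection f = Σ Word λ g → Σ Gen λ a → ∀ p → acts (g ++ a ∷ reverse g) p ≡ f p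

reflection-conj : ∀ b {f} → Reflection f → Reflection (act b ∘ f ∘ act b)
reflection-conj b {f} (g , a , h) = b ∷ g , a , λ p → begin
  act b (acts (g ++ a ∷ reverse (b ∷ g)) p)         ≡⟨ cong (λ u → act b (acts (g ++ a ∷ u) p)) (unfold-reverse b g) ⟩
  act b (acts (g ++ a ∷ reverse g ++ b ∷ []) p)     ≡⟨ cong (λ u → act b (acts u p)) (sym (++-assoc g (a ∷ reverse g) _)) ⟩
  act b (acts ((g ++ a ∷ reverse g) ++ b ∷ []) p)   ≡⟨ cong (act b) (acts-++ (g ++ a ∷ reverse g) _ p) ⟩
  act b (acts (g ++ a ∷ reverse g) (act b p))       ≡⟨ cong (act b) (h (act b p)) ⟩
  act b (f (act b p))                               ∎
  where open ≡-Reasoning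

-- Reflection in the n-th hyperplane in direction a.
reflect : Gen → ℤ → Alcove → Alcove
reflect r n (alc i j k) = alc (1ℤ + (n + n) - i) (- k - n) (- j - n)
reflect s n (alc i j k) = alc (- k - n) (1ℤ + (n + n) - j) (- i - n)
reflect t n (alc i j k) = alc (- j - n) (- i - n) (1ℤ + (n + n) - k)

reflect-here : ∀ a n p → reflect a n p ! a ≡ 1ℤ + (n + n) - p ! a
reflect-here r n p = refl
reflect-here s n p = refl
reflect-here t n p = refl

reflect-there : ∀ {a b c} → Frame a b c → ∀ n p → reflect a n p ! b ≡ - p ! c - n
reflect-there rst n p = refl
reflect-there str n p = refl
reflect-there trs n p = refl
reflect-there rts n p = refl
reflect-there tsr n p = refl
reflect-there srt n p = refl

reflect-0 : ∀ a p → act a p ≡ reflect a 0ℤ p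
reflect-0 a p with anyFrame a
... | b , c , F = alcove-ext F (trans (act-here a p) (sym (reflect-here a 0ℤ p)))
  (trans (act-there F p) (sym (trans (reflect-there F 0ℤ p) (ℤₚ.+-identityʳ _))))
  (trans (act-there (swap F) p) (sym (trans (reflect-there (swap F) 0ℤ p) (ℤₚ.+-identityʳ _))))

reflect-conj-here : ∀ a n p → act a (reflect a n (act a p)) ≡ reflect a (- n) p
reflect-conj-here a n p with anyFrame a
... | b , c , F = alcove-ext F along (across F) (across (swap F))
  where
  along = trans (act-here a _) (trans (cong (_-_ 1ℤ) (trans (reflect-here a n _)
    (cong (_-_ (1ℤ + (n + n))) (act-here a p)))) (trans (lem n (p ! a)) (sym (reflect-here a (- n) p))))
    where lem : ∀ n x → 1ℤ - (1ℤ + (n + n) - (1ℤ - x)) ≡ 1ℤ + (- n + - n) - x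
          lem = solve-∀
  across : ∀ {b c} → Frame a b c → act a (reflect a n (act a p)) ! b ≡ reflect a (- n) p ! b
  across {b} {c} F = trans (act-there F _) (trans (cong -_ (trans (reflect-there (swap F) n _)
    (cong (λ z → - z - n) (act-there F p)))) (trans (lem n (p ! c)) (sym (reflect-there F (- n) p))))
    where lem : ∀ n x → - (- - x - n) ≡ - x - - n
          lem = solve-∀

reflect-conj-there : ∀ {a b c} → Frame a b c → ∀ n p →
                     act b (reflect a n (act b p)) ≡ reflect c (- 1ℤ - n) p
reflect-conj-there {a} {b} {c} F n p = alcove-ext F
  (trans (act-there bac _) (trans (cong -_ (trans (reflect-there (swap F) n _) (cong (λ z → - z - n) (act-here b p))))
    (trans (lem₁ n (p ! b)) (sym (reflect-there cab _ p)))))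
  (trans (act-here b _) (trans (cong (_-_ 1ℤ) (trans (reflect-there F n _) (cong (λ z → - z - n) (act-there (swap bac) p))))
    (trans (lem₂ n (p ! a)) (sym (reflect-there (swap cab) _ p)))))
  (trans (act-there (swap bac) _) (trans (cong -_ (trans (reflect-here a n _) (cong (_-_ (1ℤ + (n + n))) (act-there bac p))))
    (trans (lem₃ n (p ! c)) (sym (reflect-here c _ p)))))
  where
  bac = swap (rotate F)
  cab = rotate (rotate F)
  lem₁ : ∀ n x → - (- (1ℤ - x) - n) ≡ - x - (- 1ℤ - n)
  lem₁ = solve-∀
  lem₂ : ∀ n x → 1ℤ - (- - x - n) ≡ - x - (- 1ℤ - n)
  lem₂ = solve-∀
  lem₃ : ∀ n x → - (1ℤ + (n + n) - - x) ≡ 1ℤ + (- 1ℤ - n + (- 1ℤ - n)) - x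
  lem₃ = solve-∀

reflection-≗ : ∀ {f g} → (∀ p → f p ≡ g p) → Reflection f → Reflection g
reflection-≗ eq (u , a , h) = u , a , λ p → trans (h p) (eq p)

-- Conjugation by the generator of the same direction turns hyperplane n into -n, conjugation by
-- another generator turns it into -1 - n of the third direction. Alternating the two reaches 0, -1,
-- 1, -2, 2 and so on.
reflection⁺ : ∀ n a → Reflection (reflect a (+ n))
reflection⁻ : ∀ n a → Reflection (reflect a -[1+ n ])
reflection⁺ zero    a = [] , a , reflect-0 a
reflection⁺ (suc n) a = reflection-≗ (reflect-conj-here a -[1+ n ]) (reflection-conj a (reflection⁻ n a))
reflection⁻ n c with anyFrame c
... | a , b , F = reflection-≗
  (λ p → trans (reflect-conj-there (rotate F) (+ n) p) (cong (λ m → reflect c m p) (lem n)))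
  (reflection-conj b (reflection⁺ n a))
  where lem : ∀ n → - 1ℤ - + n ≡ -[1+ n ]
        lem zero    = refl
        lem (suc n) = refl

reflection-reflect : ∀ a n → Reflection (reflect a n)
reflection-reflect a (+ n)    = reflection⁺ n a
reflection-reflect a -[1+ n ] = reflection⁻ n a

descending-reduced : ∀ {p w} → Descending p w → Reduced w
descending-reduced {p} {w} d v h = ℕₚ.≤-trans (ℕₚ.≤-reflexive
  (trans (descending-length d) (cong size (trans (sym (descending-alcove d)) (sym (alcove-~ h))))))
  (size-alcove-≤ v)

module Bruhat (ℓ : Word → ℕ) (isLength : IsLengthFn ℓ) where

  -- A letter changes `size` by at most one, so no equivalent word is shorter than `size`, and a
  -- descending word attains it.
  ℓ-size : ∀ w → ℓ w ≡ size (alcove w)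
  ℓ-size w with isLength w | descending (alcove w) (alcove-oriented w)
  ... | v , h , red , eq | u , d = trans (sym eq) (trans
    (ℕₚ.≤-antisym (red u (~-sym (~-trans h (~-descending w d))))
                  (descending-reduced d v (~-trans h (~-descending w d))))
    (descending-length d))

  ℓ-~ : ∀ {v w} → v ~ w → ℓ v ≡ ℓ w
  ℓ-~ {v} {w} h = trans (ℓ-size v) (trans (cong size (alcove-~ h)) (sym (ℓ-size w)))

  ℓ-up : ∀ a w → alcove w ! a ≤ 0ℤ → ℓ (a ∷ w) ≡ suc (ℓ w)
  ℓ-up a w h = trans (ℓ-size (a ∷ w)) (trans (size-up a (alcove w) h) (cong suc (sym (ℓ-size w))))

  ℓ-down : ∀ a w → 1ℤ ≤ alcove w ! a → suc (ℓ (a ∷ w)) ≡ ℓ w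
  ℓ-down a w h = trans (cong suc (ℓ-size (a ∷ w))) (trans (size-down a (alcove w) h) (sym (ℓ-size w)))

  descent : ∀ a w → ℓ (a ∷ w) ℕ.< ℓ w → 1ℤ ≤ alcove w ! a
  descent a w lt with ≤0⊎≥1 (alcove w ! a)
  ... | inj₂ h = h
  ... | inj₁ h = ⊥-elim (ℕₚ.<-asym lt (ℕₚ.≤-reflexive (sym (ℓ-up a w h))))

  ≤B-ℓ : ∀ {u w} → _≤B_ ℓ u w → u ~ w ⊎ ℓ u ℕ.< ℓ w
  ≤B-ℓ (b-refl h) = inj₁ h
  ≤B-ℓ (b-step τ _ le lt h) with ≤B-ℓ le
  ... | inj₁ e = inj₂ (ℕₚ.≤-<-trans (ℕₚ.≤-reflexive (ℓ-~ e)) (ℕₚ.<-≤-trans lt (ℕₚ.≤-reflexive (ℓ-~ h))))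
  ... | inj₂ l = inj₂ (ℕₚ.<-trans l (ℕₚ.<-≤-trans lt (ℕₚ.≤-reflexive (ℓ-~ h))))

  <B-ℓ : ∀ {u w} → _<B_ ℓ u w → ℓ u ℕ.< ℓ w
  <B-ℓ (le , ne) with ≤B-ℓ le
  ... | inj₁ e = ⊥-elim (ne e)
  ... | inj₂ l = l

  ≤B-respˡ : ∀ {u u′ w} → u ~ u′ → _≤B_ ℓ u w → _≤B_ ℓ u′ w
  ≤B-respˡ e (b-refl h)            = b-refl (~-trans (~-sym e) h)
  ≤B-respˡ e (b-step τ rf le lt h) = b-step τ rf (≤B-respˡ e le) lt h

  -- With ρ = g a g⁻¹ acting on the left, v = ρ y = y (y⁻¹ ρ y).
  ≤B-reflect : ∀ {u y v f} → Reflection f → alcove v ≡ f (alcove y) → ℓ y ℕ.< ℓ v →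
               _≤B_ ℓ u y → _≤B_ ℓ u v
  ≤B-reflect {u} {y} {v} {f} (g , a , h) eq lt le =
    b-step τ (reverse y ++ g , a , subst (λ z → τ ~ (reverse y ++ g) ++ a ∷ z) (sym rev)
                (subst (τ ~_) (sym (++-assoc (reverse y) g _))
                  (subst (λ z → τ ~ reverse y ++ z) (++-assoc g (a ∷ reverse g) y) ~-refl)))
           le (subst (ℓ y ℕ.<_) (sym (ℓ-~ yτ~v)) lt) yτ~v
    where
    ρ = g ++ a ∷ reverse g
    τ = reverse y ++ ρ ++ y
    rev : reverse (reverse y ++ g) ≡ reverse g ++ y
    rev = trans (reverse-++ (reverse y) g) (cong (reverse g ++_) (reverse-involutive y))
    yτ~v : y ++ τ ~ v
    yτ~v = alcove-injective (y ++ τ) v (begin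
      acts (y ++ reverse y ++ ρ ++ y) origin              ≡⟨ acts-++ y _ origin ⟩
      acts y (acts (reverse y ++ ρ ++ y) origin)          ≡⟨ cong (acts y) (acts-++ (reverse y) _ origin) ⟩
      acts y (acts (reverse y) (acts (ρ ++ y) origin))    ≡⟨ acts-reverse y _ ⟩
      acts (ρ ++ y) origin                                ≡⟨ acts-++ ρ y origin ⟩
      acts ρ (alcove y)                                   ≡⟨ h (alcove y) ⟩
      f (alcove y)                                        ≡⟨ sym eq ⟩
      alcove v                                            ∎)
      where open ≡-Reasoning

-- The Kazhdan–Lusztig recursion

abstract
  _~?_ : ∀ v w → Dec (v ~ w)
  v ~? w = map′ (λ (x , y , z) → alcove-injective v w (alcove-ext rst x y z))
                (λ h → let eq = alcove-~ h in cong (_! r) eq , cong (_! s) eq , cong (_! t) eq)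
                ((alcove v ! r ℤ.≟ alcove w ! r) ×-dec (alcove v ! s ℤ.≟ alcove w ! s) ×-dec
                 (alcove v ! t ℤ.≟ alcove w ! t))

words : ℕ → List Word
words zero    = [] ∷ []
words (suc n) = [] ∷ cartesianProductWith _∷_ (r ∷ s ∷ t ∷ []) (words n)

∈-words : ∀ w n → length w ℕ.≤ n → w ∈ words n
∈-words []      zero    _ = here refl
∈-words []      (suc n) _ = here refl
∈-words (a ∷ w) (suc n) (s≤s h) = there (∈-cartesianProductWith⁺ _∷_ (letter a) (∈-words w n h))
  where letter : ∀ a → a ∈ r ∷ s ∷ t ∷ []
        letter r = here refl
        letter s = there (here refl)
        letter t = there (there (here refl))

-- Bruhat intervals are not known to be decidable here, but a list enumerating
-- one cannot fail to exist, which suffices for equations between integers.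
enumerate : ∀ {Pr : Word → Set} → (∀ {u v} → u ~ v → Pr u → Pr v) → ∀ L →
            (∀ z → Pr z → Any (z ~_) L) → ¬ ¬ Σ (List Word) (Enumerates Pr)
enumerate {Pr} resp L bounded k = go L λ (Z , sound , complete , distinct) →
  k (Z , sound , (λ z pz → complete z pz (bounded z pz)) , distinct)
  where
  go : ∀ L → ¬ ¬ Σ (List Word) λ Z → (∀ z → z ∈ Z → Pr z) ×
         (∀ z → Pr z → Any (z ~_) L → Any (z ~_) Z) × AllPairs (λ a b → ¬ (a ~ b)) Z
  go []      k = k ([] , (λ _ ()) , (λ _ _ ()) , [])
  go (y ∷ L) k = go L (λ (Z , sound , complete , distinct) →
      case-y Z sound complete distinct (any? (y ~?_) Z))
    where
    case-y : ∀ Z → (∀ z → z ∈ Z → Pr z) → (∀ z → Pr z → Any (z ~_) L → Any (z ~_) Z) →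
             AllPairs (λ a b → ¬ (a ~ b)) Z → Dec (Any (y ~_) Z) → ⊥
    case-y Z sound complete distinct (yes q) = k (Z , sound ,
      (λ { z pz (here e) → Any.map (~-trans e) q ; z pz (there p) → complete z pz p }) , distinct)
    case-y Z sound complete distinct (no ¬q) = ¬¬py λ py → k (y ∷ Z ,
      (λ { z (here refl) → py ; z (there p) → sound z p }) ,
      (λ { z pz (here e) → here e ; z pz (there p) → there (complete z pz p) }) ,
      ¬Any⇒All¬ Z ¬q ∷ distinct)
      where
      ¬¬py : ¬ ¬ Pr y
      ¬¬py ¬py = k (Z , sound ,
        (λ { z pz (here e) → ⊥-elim (¬py (resp e pz)) ; z pz (there p) → complete z pz p }) , distinct)

-- Sums over classes of words

sum : (Word → ℤ) → List Word → ℤ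
sum f = foldr (λ z → _+_ (f z)) 0ℤ

sumP-at : ∀ (f : Word → Poly) Z k → sumP (map f Z) k ≡ sum (λ z → f z k) Z
sumP-at f []      k = refl
sumP-at f (z ∷ Z) k = cong (_+_ (f z k)) (sumP-at f Z k)

sum-cong : ∀ {f g : Word → ℤ} {Z} → All (λ z → f z ≡ g z) Z → sum f Z ≡ sum g Z
sum-cong []       = refl
sum-cong (h ∷ hs) = cong₂ _+_ h (sum-cong hs)

sum-0 : ∀ {f : Word → ℤ} {Z} → All (λ z → f z ≡ 0ℤ) Z → sum f Z ≡ 0ℤ
sum-0 []       = refl
sum-0 (h ∷ hs) = cong₂ _+_ h (sum-0 hs)

Respects : (Word → ℤ) → Set
Respects f = ∀ {u v} → u ~ v → f u ≡ f v

-- Setting f to zero on the class of y plays the role of deleting y from the list of summation,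
-- which stays untouched.
_without_ : (Word → ℤ) → Word → Word → ℤ
(f without y) z = if does (z ~? y) then 0ℤ else f z

without-same : ∀ f {y z} → z ~ y → (f without y) z ≡ 0ℤ
without-same f {y} {z} h with z ~? y
... | yes _ = refl
... | no ¬h = ⊥-elim (¬h h)

without-other : ∀ f {y z} → ¬ z ~ y → (f without y) z ≡ f z
without-other f {y} {z} ¬h with z ~? y
... | yes h = ⊥-elim (¬h h)
... | no _  = refl

without-respects : ∀ {f} y → Respects f → Respects (f without y)
without-respects {f} y resp {u} {v} h with v ~? y
... | yes e = without-same f (~-trans h e)
... | no ¬e = trans (without-other f (λ e → ¬e (~-trans (~-sym h) e))) (resp h)

sum-without : ∀ {f} → Respects f → ∀ {y Z} → Any (y ~_) Z → AllPairs (λ a b → ¬ (a ~ b)) Z →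
              sum f Z ≡ f y + sum (f without y) Z
sum-without {f} resp {y} {z ∷ Z} y∈Z (z∉Z ∷ distinct) with z ~? y | y∈Z
... | yes e | _ = trans (cong₂ _+_ (resp e)
  (sum-cong (All.map (λ ne → sym (without-other f (λ e′ → ne (~-trans e (~-sym e′))))) z∉Z)))
  (cong (_+_ (f y)) (sym (ℤₚ.+-identityˡ _)))
... | no ¬e | here e  = ⊥-elim (¬e (~-sym e))
... | no ¬e | there p = trans (cong (_+_ (f z)) (sum-without resp p distinct)) (lem (f z) (f y) _)
  where lem : ∀ a b c → a + (b + c) ≡ b + (a + c)
        lem = solve-∀

-- The members of Y are split off one by one with `_without_`; what remains of f vanishes on all of
-- Z. This replaces an unknown enumeration of an interval by a short explicit list.
sum-supported : ∀ Y {f} → Respects f → ∀ {Z} → AllPairs (λ a b → ¬ (a ~ b)) Z →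
                AllPairs (λ a b → ¬ (a ~ b)) Y → All (λ y → Any (y ~_) Z) Y →
                All (λ z → ¬ Any (z ~_) Y → f z ≡ 0ℤ) Z → sum f Z ≡ sum f Y
sum-supported []      resp dZ dY Y⊆Z vanish = sum-0 (All.map (λ h → h λ ()) vanish)
sum-supported (y ∷ Y) {f} resp {Z} dZ (y∉Y ∷ dY) (y∈Z ∷ Y⊆Z) vanish =
  trans (sum-without resp y∈Z dZ) (cong (_+_ (f y)) (trans
    (sum-supported Y (without-respects y resp) dZ dY Y⊆Z (All.map off vanish))
    (sum-cong (All.map (λ ne → without-other f (λ e → ne (~-sym e))) y∉Y))))
  where
  off : ∀ {z} → (¬ Any (z ~_) (y ∷ Y) → f z ≡ 0ℤ) → ¬ Any (z ~_) Y → (f without y) z ≡ 0ℤ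
  off {z} h ¬p with z ~? y
  ... | yes e = refl
  ... | no ¬e = h λ { (here e) → ¬e e ; (there p) → ¬p p }

shift-cong : ∀ n {p q : Poly} → p ≗P q → shift n p ≗P shift n q
shift-cong zero    h k       = h k
shift-cong (suc n) h zero    = refl
shift-cong (suc n) h (suc k) = shift-cong n h k

halfCoeff-cong : ∀ d {p q : Poly} → p ≗P q → halfCoeff d p ≡ halfCoeff d q
halfCoeff-cong zero          h = refl
halfCoeff-cong (suc zero)    h = h 0
halfCoeff-cong (suc (suc d)) h = halfCoeff-cong d (λ k → h (suc k))

halfCoeff-0 : ∀ d {p : Poly} → (∀ k → p k ≡ 0ℤ) → halfCoeff d p ≡ 0ℤ
halfCoeff-0 zero          h = refl
halfCoeff-0 (suc zero)    h = h 0
halfCoeff-0 (suc (suc d)) h = halfCoeff-0 d (λ k → h (suc k))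

-- The recursion for polynomials of degree at most one

ι : Bool → ℤ
ι false = 0ℤ
ι true  = 1ℤ

affine : Bool → Bool → Poly
affine b c 0             = ι b
affine b c 1             = ι c
affine b c (suc (suc k)) = 0ℤ

quadratic : ℤ → ℤ → Poly
quadratic x y 0                   = 0ℤ
quadratic x y 1                   = x
quadratic x y 2                   = y
quadratic x y (suc (suc (suc k))) = 0ℤ

module KazhdanLusztig (ℓ : Word → ℕ) (isLength : IsLengthFn ℓ) (P : Word → Word → Poly) (isKL : IsKL ℓ P) where

  open Bruhat ℓ isLength public
  open IsKL isKL

  infix 4 _<ᴮ_
  _<ᴮ_ : Word → Word → Set
  _<ᴮ_ = _<B_ ℓ

  μ : Word → Word → ℤ
  μ = mu ℓ P

  Distinct : List Word → Set
  Distinct = AllPairs (λ a b → ¬ (a ~ b))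

  term : Gen → Word → Word → Word → Poly
  term g v x z = scale (μ z v) (shift ⌊ (ℓ (g ∷ v) ∸ ℓ z) /2⌋ (P x z))

  μ-respˡ : ∀ {u u′} v → u ~ u′ → μ u v ≡ μ u′ v
  μ-respˡ {u} {u′} v h = trans (cong (λ n → halfCoeff (ℓ v ∸ n) (P u v)) (ℓ-~ h))
    (halfCoeff-cong (ℓ v ∸ ℓ u′) (respects h ~-refl))

  term-resp : ∀ g v x k → Respects (λ z → term g v x z k)
  term-resp g v x k {z} {z′} h = cong₂ _*_ (μ-respˡ v h)
    (trans (cong (λ n → shift ⌊ (ℓ (g ∷ v) ∸ n) /2⌋ (P x z) k) (ℓ-~ h))
           (shift-cong ⌊ (ℓ (g ∷ v) ∸ ℓ z′) /2⌋ (respects ~-refl h) k))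

  Interval : Gen → Word → Word → Set
  Interval g v z = z <ᴮ v × ℓ (g ∷ z) ℕ.< ℓ z

  interval-resp : ∀ {g v z z′} → z ~ z′ → Interval g v z → Interval g v z′
  interval-resp {g} h ((le , ne) , lt) = (≤B-respˡ h le , λ e → ne (~-trans h e)) ,
    ℕₚ.≤-trans (ℕₚ.≤-reflexive (cong suc (sym (ℓ-~ (~-cons g h))))) (ℕₚ.≤-trans lt (ℕₚ.≤-reflexive (ℓ-~ h)))

  interval-enumerable : ∀ g v → ¬ ¬ Σ (List Word) (Enumerates (Interval g v))
  interval-enumerable g v = enumerate interval-resp (words (ℓ v)) bounded
    where
    bounded : ∀ z → Interval g v z → Any (z ~_) (words (ℓ v))
    bounded z (lt , _) with isLength z
    ... | u , h , _ , eq = Any.map (λ { refl → ~-sym h })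
      (∈-words u (ℓ v) (ℕₚ.≤-trans (ℕₚ.≤-reflexive eq) (ℕₚ.<⇒≤ (<B-ℓ lt))))

  -- A certificate that the corrections are those from Y. Since `vanish` ranges over all shorter z,
  -- it can be checked from lengths and coordinates; a Bruhat relation has to be proved only for the
  -- members of Y.
  record Multiplication (g : Gen) (v : Word) (Y : List Word) : Set where
    field
      ascends  : alcove v ! g ≤ 0ℤ
      distinct : Distinct Y
      inside   : All (λ y → y <ᴮ v × 1ℤ ≤ alcove y ! g) Y
      vanish   : ∀ z → ℓ z ℕ.< ℓ v → 1ℤ ≤ alcove z ! g → ¬ Any (z ~_) Y → μ z v ≡ 0ℤ

    sum-≡ : ∀ x Z → Enumerates (Interval g v) Z → ∀ k →
            sumP (map (term g v x) Z) k ≡ sumP (map (term g v x) Y) k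
    sum-≡ x Z (sound , complete , dZ) k =
      trans (sumP-at (term g v x) Z k) (trans
        (sum-supported Y (term-resp g v x k) dZ distinct
          (All.map (λ {y} (lt , h) → complete y (lt , ℕₚ.≤-reflexive (ℓ-down g y h))) inside)
          (All.tabulate λ {z} z∈Z ¬p → trans (cong (_* shift ⌊ (ℓ (g ∷ v) ∸ ℓ z) /2⌋ (P x z) k)
             (vanish z (<B-ℓ (proj₁ (sound z z∈Z))) (descent g z (proj₂ (sound z z∈Z))) ¬p))
             (ℤₚ.*-zeroˡ (shift ⌊ (ℓ (g ∷ v) ∸ ℓ z) /2⌋ (P x z) k))))
        (sym (sumP-at (term g v x) Y k)))

    at-descent : ∀ x → 1ℤ ≤ alcove x ! g →
      P x (g ∷ v) ≗P ((P (g ∷ x) v ⊕ shift 1 (P x v)) ⊖ sumP (map (term g v x) Y))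
    at-descent x h k = decidable-stable (_ ℤ.≟ _) λ ne → interval-enumerable g v λ (Z , enum) →
      ne (trans (proj₁ (recursion g v x (ℕₚ.≤-reflexive (sym (ℓ-up g v ascends))) Z enum)
                   (ℕₚ.≤-reflexive (ℓ-down g x h)) k)
                (cong (λ y → P (g ∷ x) v k + shift 1 (P x v) k - y) (sum-≡ x Z enum k)))

    at-ascent : ∀ x → alcove x ! g ≤ 0ℤ →
      P x (g ∷ v) ≗P ((shift 1 (P (g ∷ x) v) ⊕ P x v) ⊖ sumP (map (term g v x) Y))
    at-ascent x h k = decidable-stable (_ ℤ.≟ _) λ ne → interval-enumerable g v λ (Z , enum) →
      ne (trans (proj₂ (recursion g v x (ℕₚ.≤-reflexive (sym (ℓ-up g v ascends))) Z enum)
                   (ℕₚ.≤-reflexive (sym (ℓ-up g x h))) k)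
                (cong (λ y → shift 1 (P (g ∷ x) v) k + P x v k - y) (sum-≡ x Z enum k)))

  record Affine (w : Word) (S Q : Alcove → Bool) : Set where
    constructor mkAffine
    field coefficients : ∀ x → P x w ≗P affine (S (alcove x)) (Q (alcove x))

  open Affine public

  affine-resp : ∀ {w w′ S Q} → alcove w ≡ alcove w′ → Affine w S Q → Affine w′ S Q
  affine-resp {w} {w′} eq h = mkAffine λ x k →
    trans (respects ~-refl (alcove-injective w′ w (sym eq)) k) (coefficients h x k)

  halfCoeff-affine : ∀ d b c → (d ≡ 1 → b ≡ false) → (d ≡ 3 → c ≡ false) → halfCoeff d (affine b c) ≡ 0ℤ
  halfCoeff-affine 0 b c _ _ = refl
  halfCoeff-affine 1 b c f _ = cong ι (f refl)
  halfCoeff-affine 2 b c _ _ = refl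
  halfCoeff-affine 3 b c _ f = cong ι (f refl)
  halfCoeff-affine (suc (suc (suc (suc d)))) b c _ _ = halfCoeff-0 d (λ _ → refl)

  -- For a polynomial of degree at most 1 the coefficient defining μ can be nonzero only for length
  -- difference 1, where it is the constant term, or 3, where it is the linear one.
  μ-vanish : ∀ {v S Q} → Affine v S Q → ∀ z → ℓ z ℕ.< ℓ v →
             (1 ℕ.+ ℓ z ≡ ℓ v → S (alcove z) ≡ false) → (3 ℕ.+ ℓ z ≡ ℓ v → Q (alcove z) ≡ false) →
             μ z v ≡ 0ℤ
  μ-vanish {v} {S} {Q} h z lt f₁ f₃ = trans (halfCoeff-cong (ℓ v ∸ ℓ z) (coefficients h z))
    (halfCoeff-affine (ℓ v ∸ ℓ z) (S (alcove z)) (Q (alcove z)) (f₁ ∘ diff) (f₃ ∘ diff))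
    where
    diff : ∀ {d} → ℓ v ∸ ℓ z ≡ d → d ℕ.+ ℓ z ≡ ℓ v
    diff refl = ℕₚ.m∸n+n≡m (ℕₚ.<⇒≤ lt)

  module _ {g v S Q} (up : alcove v ! g ≤ 0ℤ) (hv : Affine v S Q) where

    shift-term : ∀ d {y} → d ℕ.+ ℓ y ≡ ℓ v → μ y v ≡ 1ℤ → ∀ x →
                 term g v x y ≗P shift ⌊ suc d /2⌋ (P x y)
    shift-term d {y} eq μ≡1 x k = trans (cong₂ _*_ μ≡1 (cong (λ n → shift ⌊ n /2⌋ (P x y) k) diff)) (ℤₚ.*-identityˡ _)
      where
      diff : ℓ (g ∷ v) ∸ ℓ y ≡ suc d
      diff = trans (cong (_∸ ℓ y) (trans (ℓ-up g v up) (cong suc (sym eq)))) (ℕₚ.m+n∸n≡m (suc d) (ℓ y))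

    μ-diff : ∀ d {y} → d ℕ.+ ℓ y ≡ ℓ v → μ y v ≡ halfCoeff d (affine (S (alcove y)) (Q (alcove y)))
    μ-diff d {y} eq = trans (cong (λ n → halfCoeff n (P y v)) (trans (cong (_∸ ℓ y) (sym eq)) (ℕₚ.m+n∸n≡m d (ℓ y))))
      (halfCoeff-cong d (coefficients hv y))

    term₁ : ∀ {y S′ Q′} → Affine y S′ Q′ → 1 ℕ.+ ℓ y ≡ ℓ v → S (alcove y) ≡ true → ∀ x →
            term g v x y ≗P quadratic (ι (S′ (alcove x))) (ι (Q′ (alcove x)))
    term₁ hy eq s≡ x k = trans (shift-term 1 eq (trans (μ-diff 1 eq) (cong ι s≡)) x k)
      (trans (shift-cong 1 (coefficients hy x) k) (lem k))
      where lem : ∀ {b c} → shift 1 (affine b c) ≗P quadratic (ι b) (ι c)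
            lem 0 = refl
            lem 1 = refl
            lem 2 = refl
            lem (suc (suc (suc k))) = refl

    -- Length difference 3 shifts by q², so a linear term of y would produce q³; the corrections of
    -- this kind come from the family `U`, whose polynomials are constant.
    term₃ : ∀ {y S′} → Affine y S′ (λ _ → false) → 3 ℕ.+ ℓ y ≡ ℓ v → Q (alcove y) ≡ true → ∀ x →
            term g v x y ≗P quadratic 0ℤ (ι (S′ (alcove x)))
    term₃ hy eq q≡ x k = trans (shift-term 3 eq (trans (μ-diff 3 eq) (cong ι q≡)) x k)
      (trans (shift-cong 2 (coefficients hy x) k) (lem k))
      where lem : ∀ {b} → shift 2 (affine b false) ≗P quadratic 0ℤ (ι b)
            lem 0 = refl
            lem 1 = refl
            lem 2 = refl
            lem 3 = refl
            lem (suc (suc (suc (suc k)))) = refl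

    -- Comparison of powers of q. The unshifted polynomial belongs to the shorter of x and gx, the
    -- one multiplied by q to the longer. Hence the new constant term is S below, the new linear
    -- term is Q below plus S above minus α, and the term q² given by Q above has to be cancelled by
    -- β.
    affine-multiplication : ∀ {Y S′ Q′} (α β : Alcove → ℤ) → Multiplication g v Y →
      (∀ x → sumP (map (term g v x) Y) ≗P quadratic (α (alcove x)) (β (alcove x))) →
      (∀ p → Oriented p → 1ℤ ≤ p ! g → S′ p ≡ S (act g p) × ι (Q′ p) + α p ≡ ι (Q (act g p)) + ι (S p) × ι (Q p) ≡ β p) →
      (∀ p → Oriented p → p ! g ≤ 0ℤ → S′ p ≡ S p × ι (Q′ p) + α p ≡ ι (Q p) + ι (S (act g p)) × ι (Q (act g p)) ≡ β p) →
      Affine (g ∷ v) S′ Q′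
    affine-multiplication {Y} {S′} {Q′} α β M sums desc asc = mkAffine λ x → go x (≤0⊎≥1 (alcove x ! g))
      where
      combine : ∀ {sl ql sh qh s′ q′ α β} → s′ ≡ sl → ι q′ + α ≡ ι ql + ι sh → ι qh ≡ β →
                ((affine sl ql ⊕ shift 1 (affine sh qh)) ⊖ quadratic α β) ≗P affine s′ q′
      combine {sl} refl _ _ 0 = trans (ℤₚ.+-identityʳ _) (ℤₚ.+-identityʳ (ι sl))
      combine {q′ = q′} {α} _ eq _ 1 = trans (cong (_- α) (sym eq)) (lem (ι q′) α)
        where lem : ∀ a b → a + b - b ≡ a
              lem = solve-∀
      combine {qh = qh} _ _ refl 2 = lem (ι qh)
        where lem : ∀ a → 0ℤ + a - a ≡ 0ℤ
              lem = solve-∀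
      combine _ _ _ (suc (suc (suc k))) = refl
      go : ∀ x → let p = alcove x in p ! g ≤ 0ℤ ⊎ 1ℤ ≤ p ! g → P x (g ∷ v) ≗P affine (S′ p) (Q′ p)
      go x (inj₁ h) k with asc (alcove x) (alcove-oriented x) h
      ... | e₀ , e₁ , e₂ = trans (Multiplication.at-ascent M x h k) (trans
        (cong₂ _-_ (trans (ℤₚ.+-comm (shift 1 (P (g ∷ x) v) k) (P x v k))
                          (cong₂ _+_ (coefficients hv x k) (shift-cong 1 (coefficients hv (g ∷ x)) k))) (sums x k))
        (combine e₀ e₁ e₂ k))
      go x (inj₂ h) k with desc (alcove x) (alcove-oriented x) h
      ... | e₀ , e₁ , e₂ = trans (Multiplication.at-descent M x h k) (trans
        (cong₂ _-_ (cong₂ _+_ (coefficients hv (g ∷ x) k) (shift-cong 1 (coefficients hv x) k)) (sums x k))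
        (combine e₀ e₁ e₂ k))

-- Supports and linear parts

-- Up to the symmetries of the generators, E m = (0, m, -m) and O m = (0, m, 1 - m)
-- are the elements of length 2m and 2m - 1 in c₁; U m = (1, m, -m) and
-- V m = (1, m, -m-1) lie in c₀ next to them.
data Kind : Set where
  E O U V : Kind

-- support X m is the set of x with P_{x,X m}(0) = 1, and linearPart X m the set of x
-- for which q occurs in P_{x,X m}.
data Region : Set where
  identity           : Region
  support linearPart : Kind → Region

-- The level is an integer, so m - 1 and m - 2 may be negative. For `E`, `O` and `U` the left sides
-- of the first three inequalities sum to zero while the right sides then have negative sum: such
-- regions are empty, and the linear parts need no separate clauses at low levels.
form : Region → (i j k m : Exp n) → Form n
form identity i j k m = i ≐′ con 0ℤ ∧′ j ≐′ con 0ℤ ∧′ k ≐′ con 0ℤ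
form (support E) i j k m =
  i ⊝ k ≤′ m ∧′ j ⊝ i ≤′ m ∧′ k ⊝ j ≤′ m ⊝ con (+ 1)
form (support O) i j k m =
  i ⊝ k ≤′ m ⊝ con (+ 1) ∧′ j ⊝ i ≤′ m ∧′ k ⊝ j ≤′ m ⊝ con (+ 1) ∧′
  -- For m ≥ 2 the second alternative implies the first. At m = 1 the first bound would be -1, which
  -- wrongly excludes the origin and the generator itself.
  (k ⊝ i ≤′ m ⊹ m ⊝ con (+ 3) ∨′ k ≤′ i)
form (support U) i j k m =
  i ⊝ k ≤′ m ⊹ con (+ 1) ∧′ j ⊝ i ≤′ m ∧′ k ⊝ j ≤′ m ⊝ con (+ 1)
form (support V) i j k m =
  i ⊝ k ≤′ m ⊹ con (+ 2) ∧′ j ⊝ i ≤′ m ⊹ con (+ 1) ∧′ k ⊝ j ≤′ m ∧′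
  j ⊝ k ≤′ m ⊹ m ⊹ con (+ 1) ∧′ i ⊝ j ≤′ m ⊹ m ∧′ k ⊝ i ≤′ m ⊹ m ⊝ con (+ 1)
form (linearPart E) i j k m =
  form (support O) i j k (m ⊝ con (+ 1)) ∨′ form (support U) j k i (m ⊝ con (+ 2))
form (linearPart O) i j k m = form (support E) i j k (m ⊝ con (+ 2))
form (linearPart U) i j k m = ⊥′
form (linearPart V) i j k m = form (support U) i j k (m ⊝ con (+ 1))

contains : Region → (i j k m : ℤ) → Bool
contains R i j k m = ev (form R (var zero) (var (suc zero)) (var (suc (suc zero))) (var (suc (suc (suc zero)))))
                        (i ∷ j ∷ k ∷ m ∷ [])

-- Substitution commutes with evaluation by computation, once the region is a constructor.
ev-form : ∀ R (i j k m : Exp n) ρ → ev (form R i j k m) ρ ≡ contains R (⟦ i ⟧ ρ) (⟦ j ⟧ ρ) (⟦ k ⟧ ρ) (⟦ m ⟧ ρ)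
ev-form identity i j k m ρ       = refl
ev-form (support E) i j k m ρ    = refl
ev-form (support O) i j k m ρ    = refl
ev-form (support U) i j k m ρ    = refl
ev-form (support V) i j k m ρ    = refl
ev-form (linearPart E) i j k m ρ = refl
ev-form (linearPart O) i j k m ρ = refl
ev-form (linearPart U) i j k m ρ = refl
ev-form (linearPart V) i j k m ρ = refl

-- Multiplication steps as formulas of linear arithmetic

data Rotation : Set where
  abc bca cab : Rotation

-- Rotations suffice: the elements met in one step sit in cyclically related frames, and mirror
-- images arise from the choice of the frame itself.
turn : ∀ {A B : Set} → Rotation → (A → A → A → B) → A → A → A → B
turn abc f i j k = f i j k
turn bca f i j k = f j k i
turn cab f i j k = f k i j

-- The region R, read in the rotated frame, at level base + n.
record Piece : Set where
  constructor piece
  field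
    region   : Region
    rotation : Rotation
    base     : ℕ

I K N : Exp 3
I = var zero
K = var (suc zero)
N = var (suc (suc zero))

-- The total is 0 or 1 according to σ, which determines the middle coordinate; eliminating it leaves
-- three variables and no side condition on the orientation.
J : Bool → Exp 3
J σ = con (ι σ) ⊝ I ⊝ K

pieceForm : Piece → (i j k : Exp 3) → Form 3
pieceForm (piece R ρ c) = turn ρ (λ i j k → form R i j k (con (+ c) ⊹ N))

inPiece : Piece → ℕ → (i j k : ℤ) → Bool
inPiece (piece R ρ c) n = turn ρ (λ i j k → contains R i j k (+ (c ℕ.+ n)))

ev-piece : ∀ p (i j k : Exp 3) x y n → let ρ = x ∷ y ∷ + n ∷ [] in
           ev (pieceForm p i j k) ρ ≡ inPiece p n (⟦ i ⟧ ρ) (⟦ j ⟧ ρ) (⟦ k ⟧ ρ)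
ev-piece (piece R abc c) i j k x y n = ev-form R i j k (con (+ c) ⊹ N) _
ev-piece (piece R bca c) i j k x y n = ev-form R j k i (con (+ c) ⊹ N) _
ev-piece (piece R cab c) i j k x y n = ev-form R k i j (con (+ c) ⊹ N) _

Triple : Set
Triple = Exp 3 × Exp 3 × Exp 3

alternatives : Exp 3 → (Exp 3 → Form 3) → Form 3
alternatives e f = f e ∨′ f (neg e)

-- The bound L ≤ d + |i| + |j| + |k| without absolute values: some choice of signs attains the sum.
-- Only this inequality between lengths is encoded, which can only enlarge the set to be shown to
-- lie in a correction list.
longer : ℕ → Exp 3 → (i j k : Exp 3) → Form 3
longer d L i j k = alternatives i λ i′ → alternatives j λ j′ → alternatives k λ k′ →
  L ≤′ con (+ d) ⊹ i′ ⊹ j′ ⊹ k′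

alternatives-intro : ∀ e f {ρ} → (∀ e′ → ⟦ e′ ⟧ ρ ≡ + ∣ ⟦ e ⟧ ρ ∣ → ρ ⊨ f e′) → ρ ⊨ alternatives e f
alternatives-intro e f {ρ} h with ⟦ e ⟧ ρ in eq
... | + n      = inj₁ (h e eq)
... | -[1+ n ] = inj₂ (h (neg e) (cong -_ eq))

longer-intro : ∀ d L i j k {ρ} → ⟦ L ⟧ ρ ≤ + (d ℕ.+ ∣ ⟦ i ⟧ ρ ∣ ℕ.+ ∣ ⟦ j ⟧ ρ ∣ ℕ.+ ∣ ⟦ k ⟧ ρ ∣) →
               ρ ⊨ longer d L i j k
longer-intro d L i j k {ρ} h =
  alternatives-intro i (λ i′ → alternatives j λ j′ → alternatives k λ k′ → L ≤′ con (+ d) ⊹ i′ ⊹ j′ ⊹ k′) λ i′ ei →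
  alternatives-intro j (λ j′ → alternatives k λ k′ → L ≤′ con (+ d) ⊹ i′ ⊹ j′ ⊹ k′) λ j′ ej →
  alternatives-intro k (λ k′ → L ≤′ con (+ d) ⊹ i′ ⊹ j′ ⊹ k′) λ k′ ek →
  subst (⟦ L ⟧ ρ ≤_) (sym (cong₂ _+_ (cong₂ _+_ (cong (_+_ (+ d)) ei) ej) ek)) h

⋁ : List (Form 3) → Form 3
⋁ []       = ⊥′
⋁ (f ∷ fs) = f ∨′ ⋁ fs

-- In coordinates with the multiplying generator first: v times that generator is w,
-- up to corrections at the elements listed in near (of length l(v) - 1) and far (of
-- length l(v) - 3).
record Step : Set where
  field
    supportV linearV supportW : Piece
    -- The linear part of w plus the corrections of degree 1 is lhs₁ + lhs₂.
    lhs₁ lhs₂ : Piece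
    quadraticPart : Piece
    small    : Bool
    lengthV  : Exp 3
    near far : List Triple

  parameter : Form 3
  parameter with small
  ... | true  = N ≐′ con 0ℤ
  ... | false = con 0ℤ ≤′ N

  members : Piece → List Triple → Form 3
  members p []                 = con 0ℤ ≤′ con 0ℤ
  members p ((i , j , k) ∷ ts) = pieceForm p i j k ∧′ members p ts

  module _ (σ : Bool) where

    identities : (i j k i′ j′ k′ : Exp 3) → Form 3
    identities i j k i′ j′ k′ =
      let S = pieceForm supportW I (J σ) K
          A = pieceForm lhs₁ I (J σ) K
          D = pieceForm lhs₂ I (J σ) K
          B = pieceForm quadraticPart I (J σ) K
          lowerS = pieceForm supportV i j k
          lowerQ = pieceForm linearV i j k
          upperS = pieceForm supportV i′ j′ k′
          upperQ = pieceForm linearV i′ j′ k′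
      -- Sums of two indicators agree exactly when both the conjunctions and the disjunctions agree;
      -- this expresses the linear coefficient without arithmetic on truth values.
      in (S ⇔′ lowerS) ∧′ (A ∧′ D ⇔′ lowerQ ∧′ upperS) ∧′ (A ∨′ D ⇔′ lowerQ ∨′ upperS) ∧′ (upperQ ⇔′ B)

    atDescent atAscent : Form 3
    atDescent = parameter ∧′ con 1ℤ ≤′ I ⇒′ identities (con 1ℤ ⊝ I) (neg K) (neg (J σ)) I (J σ) K
    atAscent  = parameter ∧′ I ≤′ con 0ℤ ⇒′ identities I (J σ) K (con 1ℤ ⊝ I) (neg K) (neg (J σ))

    equals : Triple → Form 3
    equals (i , j , k) = I ≐′ i ∧′ J σ ≐′ j ∧′ K ≐′ k

    -- Completeness of a correction list: an alcove in the region that has the descent and is long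
    -- enough must be listed. Conversely `members` places the listed elements in the region, so that
    -- their μ is 1.
    listed : ℕ → Piece → List Triple → Form 3
    listed d p ts = parameter ∧′ con 1ℤ ≤′ I ∧′ pieceForm p I (J σ) K ∧′ longer d lengthV I (J σ) K ⇒′
                    ⋁ (map equals ts)

    correct : Form 3
    correct = atDescent ∧′ atAscent ∧′ listed 1 supportV near ∧′ listed 3 linearV far ∧′
              (parameter ⇒′ members supportV near ∧′ members linearV far)

level : ℕ → Exp 3
level c = con (+ c) ⊹ N

nothing : Piece
nothing = piece (linearPart U) abc 0

-- stepO, stepE, stepU, stepV lead to O (n+4), E (n+3), U (n+2), V (n+1).  At the
-- lowest levels some corrections are missing: stepX₀, stepX₁, stepX₂ start from an
-- element of level 0, 1, 2.
stepO stepO₂ stepO₁ stepO₀ stepE stepE₂ stepE₁ stepU stepU₁ stepV : Step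
stepO = record
  { supportV = piece (support E) bca 3 ; linearV = piece (linearPart E) bca 3
  ; supportW = piece (support O) cab 4
  ; lhs₁ = piece (linearPart O) cab 4 ; lhs₂ = piece (support U) cab 2
  ; quadraticPart = piece (support U) cab 1
  ; small = false ; lengthV = level 3 ⊹ level 3
  ; near = (level 2 , neg (level 2) , con 1ℤ) ∷ []
  ; far  = (level 1 , neg (level 1) , con 1ℤ) ∷ [] }
stepO₂ = record
  { supportV = piece (support E) bca 2 ; linearV = piece (linearPart E) bca 2
  ; supportW = piece (support O) cab 3
  ; lhs₁ = piece (linearPart O) cab 3 ; lhs₂ = piece (support U) cab 1
  ; quadraticPart = nothing
  ; small = true ; lengthV = level 2 ⊹ level 2
  -- The far element of `stepO` would be (0, 0, 1) here; its first coordinate is not positive, so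
  -- the generator is not a descent.
  ; near = (level 1 , neg (level 1) , con 1ℤ) ∷ [] ; far = [] }
stepO₁ = record
  { supportV = piece (support E) bca 1 ; linearV = piece (linearPart E) bca 1
  ; supportW = piece (support O) cab 2
  ; lhs₁ = piece (linearPart O) cab 2 ; lhs₂ = nothing
  ; quadraticPart = nothing
  ; small = true ; lengthV = level 1 ⊹ level 1
  ; near = [] ; far = [] }
stepO₀ = record
  { supportV = piece identity abc 0 ; linearV = nothing
  ; supportW = piece (support O) cab 1
  ; lhs₁ = piece (linearPart O) cab 1 ; lhs₂ = nothing
  ; quadraticPart = nothing
  ; small = true ; lengthV = con 0ℤ
  ; near = [] ; far = [] }
stepE = record
  { supportV = piece (support O) bca 3 ; linearV = piece (linearPart O) bca 3
  ; supportW = piece (support E) cab 3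
  ; lhs₁ = piece (linearPart E) cab 3 ; lhs₂ = piece (support V) cab 1
  ; quadraticPart = piece (linearPart V) cab 1
  ; small = false ; lengthV = level 3 ⊹ level 2
  ; near = (level 1 , neg (level 2) , con 1ℤ) ∷ [] ; far = [] }
stepE₂ = record
  { supportV = piece (support O) bca 2 ; linearV = piece (linearPart O) bca 2
  ; supportW = piece (support E) cab 2
  ; lhs₁ = piece (linearPart E) cab 2 ; lhs₂ = nothing
  ; quadraticPart = nothing
  ; small = true ; lengthV = level 2 ⊹ level 1
  ; near = [] ; far = [] }
stepE₁ = record
  { supportV = piece (support O) bca 1 ; linearV = piece (linearPart O) bca 1
  ; supportW = piece (support E) cab 1
  ; lhs₁ = piece (linearPart E) cab 1 ; lhs₂ = nothing
  ; quadraticPart = nothing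
  ; small = true ; lengthV = level 1 ⊹ level 0
  ; near = [] ; far = [] }
stepU = record
  { supportV = piece (support E) abc 2 ; linearV = piece (linearPart E) abc 2
  ; supportW = piece (support U) abc 2
  ; lhs₁ = piece (support U) abc 1 ; lhs₂ = piece (support O) cab 2
  ; quadraticPart = piece (linearPart O) cab 2
  ; small = false ; lengthV = level 2 ⊹ level 2
  ; near = (con 1ℤ , level 1 , neg (level 1)) ∷ (level 2 , neg (level 1) , con 0ℤ) ∷ [] ; far = [] }
stepU₁ = record
  { supportV = piece (support E) abc 1 ; linearV = piece (linearPart E) abc 1
  ; supportW = piece (support U) abc 1
  ; lhs₁ = nothing ; lhs₂ = piece (support O) cab 1
  ; quadraticPart = piece (linearPart O) cab 1
  ; small = true ; lengthV = level 1 ⊹ level 1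
  -- The two near elements of `stepU` would coincide here, both being (1, 0, 0), and count once.
  ; near = (level 1 , neg (level 0) , con 0ℤ) ∷ [] ; far = [] }
stepV = record
  { supportV = piece (support O) abc 2 ; linearV = piece (linearPart O) abc 2
  ; supportW = piece (support V) abc 1
  ; lhs₁ = piece (linearPart V) abc 1 ; lhs₂ = piece (support E) cab 1
  ; quadraticPart = piece (linearPart E) cab 1
  ; small = false ; lengthV = level 2 ⊹ level 1
  ; near = (level 1 , neg (level 1) , con 0ℤ) ∷ [] ; far = [] }

-- Verification of the steps by computation

Correct : Step → Set
Correct S = ∀ σ → valid (Step.correct S σ) ≡ true

stepO-correct : Correct stepO
stepO-correct false = refl
stepO-correct true  = refl

stepO₂-correct : Correct stepO₂
stepO₂-correct false = refl
stepO₂-correct true  = refl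

stepO₁-correct : Correct stepO₁
stepO₁-correct false = refl
stepO₁-correct true  = refl

stepE-correct : Correct stepE
stepE-correct false = refl
stepE-correct true  = refl

stepE₂-correct : Correct stepE₂
stepE₂-correct false = refl
stepE₂-correct true  = refl

stepE₁-correct : Correct stepE₁
stepE₁-correct false = refl
stepE₁-correct true  = refl

stepU-correct : Correct stepU
stepU-correct false = refl
stepU-correct true  = refl

stepU₁-correct : Correct stepU₁
stepU₁-correct false = refl
stepU₁-correct true  = refl

stepV-correct : Correct stepV
stepV-correct false = refl
stepV-correct true  = refl

stepO₀-correct : Correct stepO₀
stepO₀-correct false = refl
stepO₀-correct true  = refl

-- From formulas to identities between coefficients

cong₃ : ∀ {A B : Set} (f : A → A → A → B) {x x′ y y′ z z′} → x ≡ x′ → y ≡ y′ → z ≡ z′ → f x y z ≡ f x′ y′ z′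
cong₃ f refl refl refl = refl

record At {a b c} (F : Frame a b c) (q : Alcove) (i j k : ℤ) : Set where
  constructor coordinates
  field
    first  : q ! a ≡ i
    second : q ! b ≡ j
    third  : q ! c ≡ k

open At public

regionIn : ∀ {a b c} → Frame a b c → Piece → ℕ → Alcove → Bool
regionIn {a} {b} {c} F p n q = inPiece p n (q ! a) (q ! b) (q ! c)

regionIn-act : ∀ {a b c} (F : Frame a b c) p n q →
               regionIn F p n (act a q) ≡ inPiece p n (1ℤ - q ! a) (- q ! c) (- q ! b)
regionIn-act {a} F p n q = cong₃ (inPiece p n) (act-here a q) (act-there F q) (act-there (swap F) q)

middle : ∀ {a b c} (F : Frame a b c) q → Oriented q → ∃ λ σ → q ! b ≡ ι σ - q ! a - q ! c
middle {a} {b} {c} F q o = go o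
  where
  lem : ∀ i j k → j ≡ i + j + k - i - k
  lem = solve-∀
  go : Oriented q → ∃ λ σ → q ! b ≡ ι σ - q ! a - q ! c
  go (inj₁ h) = false , trans (lem (q ! a) (q ! b) (q ! c)) (cong (λ z → z - q ! a - q ! c) (trans (sym (total-frame F q)) h))
  go (inj₂ h) = true , trans (lem (q ! a) (q ! b) (q ! c)) (cong (λ z → z - q ! a - q ! c) (trans (sym (total-frame F q)) h))

ι-sum : ∀ a d b c → a ∧ d ≡ b ∧ c → a ∨ d ≡ b ∨ c → ι a + ι d ≡ ι b + ι c
ι-sum a d b c p q = trans (lem a d) (trans (cong₂ _+_ (cong ι p) (cong ι q)) (sym (lem b c)))
  where
  lem : ∀ a d → ι a + ι d ≡ ι (a ∧ d) + ι (a ∨ d)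
  lem false false = refl
  lem false true  = refl
  lem true  false = refl
  lem true  true  = refl

parameter-⊨ : ∀ S {n} → (Step.small S ≡ true → n ≡ 0) → ∀ {x y} → (x ∷ y ∷ + n ∷ []) ⊨ Step.parameter S
parameter-⊨ S h with Step.small S
... | true  = ℤₚ.≤-reflexive (cong +_ (h refl)) , +≤+ z≤n
... | false = +≤+ z≤n

module _ (S : Step) (correct : Correct S) (n : ℕ) (admissible : Step.small S ≡ true → n ≡ 0) where

  open Step S hiding (correct)

  parameter-holds : ∀ x y → (x ∷ y ∷ + n ∷ []) ⊨ parameter
  parameter-holds x y = parameter-⊨ S admissible

  record Identities (i j k i₁ j₁ k₁ i₂ j₂ k₂ : ℤ) : Set where
    constructor ids
    field
      constantCoeff  : inPiece supportW n i j k ≡ inPiece supportV n i₁ j₁ k₁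
      linearCoeff    : ι (inPiece lhs₁ n i j k) + ι (inPiece lhs₂ n i j k) ≡
                       ι (inPiece linearV n i₁ j₁ k₁) + ι (inPiece supportV n i₂ j₂ k₂)
      quadraticCoeff : inPiece linearV n i₂ j₂ k₂ ≡ inPiece quadraticPart n i j k

  identities-sound : ∀ σ (i j k i′ j′ k′ : Exp 3) x y → let ρ = x ∷ y ∷ + n ∷ [] in
    ρ ⊨ identities σ i j k i′ j′ k′ →
    Identities x (ι σ - x - y) y (⟦ i ⟧ ρ) (⟦ j ⟧ ρ) (⟦ k ⟧ ρ) (⟦ i′ ⟧ ρ) (⟦ j′ ⟧ ρ) (⟦ k′ ⟧ ρ)
  identities-sound σ i j k i′ j′ k′ x y (h₀ , h₁ , h₂ , h₃) = ids
    (trans (sym (ev-at supportW I (J σ) K)) (trans (ev-cong (pieceForm supportW I (J σ) K) (pieceForm supportV i j k) h₀)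
      (ev-at supportV i j k)))
    (ι-sum (inPiece lhs₁ n _ _ _) (inPiece lhs₂ n _ _ _) (inPiece linearV n _ _ _) (inPiece supportV n _ _ _)
      (trans (cong₂ _∧_ (sym (ev-at lhs₁ I (J σ) K)) (sym (ev-at lhs₂ I (J σ) K)))
      (trans (ev-cong (pieceForm lhs₁ I (J σ) K ∧′ pieceForm lhs₂ I (J σ) K)
                      (pieceForm linearV i j k ∧′ pieceForm supportV i′ j′ k′) h₁)
        (cong₂ _∧_ (ev-at linearV i j k) (ev-at supportV i′ j′ k′))))
      (trans (cong₂ _∨_ (sym (ev-at lhs₁ I (J σ) K)) (sym (ev-at lhs₂ I (J σ) K)))
      (trans (ev-cong (pieceForm lhs₁ I (J σ) K ∨′ pieceForm lhs₂ I (J σ) K)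
                      (pieceForm linearV i j k ∨′ pieceForm supportV i′ j′ k′) h₂)
        (cong₂ _∨_ (ev-at linearV i j k) (ev-at supportV i′ j′ k′)))))
    (trans (sym (ev-at linearV i′ j′ k′)) (trans (ev-cong (pieceForm linearV i′ j′ k′) (pieceForm quadraticPart I (J σ) K) h₃)
      (ev-at quadraticPart I (J σ) K)))
    where
    ev-at : ∀ p (i j k : Exp 3) → let ρ = x ∷ y ∷ + n ∷ [] in
            ev (pieceForm p i j k) ρ ≡ inPiece p n (⟦ i ⟧ ρ) (⟦ j ⟧ ρ) (⟦ k ⟧ ρ)
    ev-at p i j k = ev-piece p i j k x y n

  coordinates-descent : ∀ σ {i j k} → j ≡ ι σ - i - k → 1ℤ ≤ i →
                        Identities i j k (1ℤ - i) (- k) (- j) i j k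
  coordinates-descent σ {i} {j} {k} refl h = identities-sound σ (con 1ℤ ⊝ I) (neg K) (neg (J σ)) I (J σ) K i k
    (proj₁ (solve (Step.correct S σ) (correct σ) (i ∷ k ∷ + n ∷ [])) (parameter-holds i k , h))

  coordinates-ascent : ∀ σ {i j k} → j ≡ ι σ - i - k → i ≤ 0ℤ →
                       Identities i j k i j k (1ℤ - i) (- k) (- j)
  coordinates-ascent σ {i} {j} {k} refl h = identities-sound σ I (J σ) K (con 1ℤ ⊝ I) (neg K) (neg (J σ)) i k
    (proj₁ (proj₂ (solve (Step.correct S σ) (correct σ) (i ∷ k ∷ + n ∷ []))) (parameter-holds i k , h))

  -- The triples of the steps involve only the level N, so zeros serve as values of the other two
  -- variables.
  Members : Piece → List Triple → Set
  Members p = All λ (i , j , k) → let ρ = 0ℤ ∷ 0ℤ ∷ + n ∷ [] in inPiece p n (⟦ i ⟧ ρ) (⟦ j ⟧ ρ) (⟦ k ⟧ ρ) ≡ true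

  members-sound : ∀ p ts → (0ℤ ∷ 0ℤ ∷ + n ∷ []) ⊨ members p ts → Members p ts
  members-sound p []                 h        = []
  members-sound p ((i , j , k) ∷ ts) (h , hs) =
    trans (sym (ev-piece p i j k 0ℤ 0ℤ n)) (Equivalence.to T-≡ (ev-complete (pieceForm p i j k) h)) ∷ members-sound p ts hs

  near-members : Members supportV near
  near-members = members-sound supportV near (proj₁
    (proj₂ (proj₂ (proj₂ (proj₂ (solve (Step.correct S false) (correct false) _)))) (parameter-holds 0ℤ 0ℤ)))

  far-members : Members linearV far
  far-members = members-sound linearV far (proj₂
    (proj₂ (proj₂ (proj₂ (proj₂ (solve (Step.correct S false) (correct false) _)))) (parameter-holds 0ℤ 0ℤ)))

  module _ {a b c} (F : Frame a b c) where

    CoefficientIdentities : (q lower upper : Alcove) → Set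
    CoefficientIdentities q lower upper =
      regionIn F supportW n q ≡ regionIn F supportV n lower ×
      ι (regionIn F lhs₁ n q) + ι (regionIn F lhs₂ n q) ≡
        ι (regionIn F linearV n lower) + ι (regionIn F supportV n upper) ×
      regionIn F linearV n upper ≡ regionIn F quadraticPart n q

    identities-descent : ∀ q → Oriented q → 1ℤ ≤ q ! a → CoefficientIdentities q (act a q) q
    identities-descent q o h = let σ , eq = middle F q o ; ids e₀ e₁ e₂ = coordinates-descent σ eq h in
      trans e₀ (sym (regionIn-act F supportV n q)) ,
      trans e₁ (cong (λ z → ι z + ι (regionIn F supportV n q)) (sym (regionIn-act F linearV n q))) ,
      e₂

    identities-ascent : ∀ q → Oriented q → q ! a ≤ 0ℤ → CoefficientIdentities q q (act a q)
    identities-ascent q o h = let σ , eq = middle F q o ; ids e₀ e₁ e₂ = coordinates-ascent σ eq h in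
      e₀ ,
      trans e₁ (cong (λ z → ι (regionIn F linearV n q) + ι z) (sym (regionIn-act F supportV n q))) ,
      trans (regionIn-act F linearV n q) e₂

    Lists : List Triple → Alcove → Set
    Lists ts q = Any (λ (i , j , k) → let ρ = q ! a ∷ q ! c ∷ + n ∷ [] in
                     At F q (⟦ i ⟧ ρ) (⟦ j ⟧ ρ) (⟦ k ⟧ ρ)) ts

    module _ (q : Alcove) (o : Oriented q) (desc : 1ℤ ≤ q ! a)
             (len : ℕ) (len≡ : ∀ x y → ⟦ lengthV ⟧ (x ∷ y ∷ + n ∷ []) ≡ + len) where

      ⋁-sound : ∀ σ → q ! b ≡ ι σ - q ! a - q ! c → ∀ ts →
                (q ! a ∷ q ! c ∷ + n ∷ []) ⊨ ⋁ (map (equals σ) ts) → Lists ts q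
      ⋁-sound σ eq []       (+≤+ ())
      ⋁-sound σ eq (_ ∷ ts) (inj₁ (hi , hj , hk)) = here (coordinates (≐-elim hi) (trans eq (≐-elim hj)) (≐-elim hk))
      ⋁-sound σ eq (_ ∷ ts) (inj₂ h)              = there (⋁-sound σ eq ts h)

      listed-sound : ∀ d p ts → (∀ σ → (q ! a ∷ q ! c ∷ + n ∷ []) ⊨ listed σ d p ts) →
                     d ℕ.+ size q ≡ len → regionIn F p n q ≡ true → Lists ts q
      listed-sound d p ts h dist inside with middle F q o
      ... | σ , eq = ⋁-sound σ eq ts (h σ (parameter-holds _ _ , desc ,
        ev-sound (pieceForm p I (J σ) K) (subst T (sym (trans (ev-piece p I (J σ) K _ _ n)
          (trans (cong (λ z → inPiece p n (q ! a) z (q ! c)) (sym eq)) inside))) tt) ,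
        longer-intro d lengthV I (J σ) K (subst (_≤ _) (sym (len≡ _ _)) (+≤+ (ℕₚ.≤-reflexive (begin
          len                                                              ≡⟨ sym dist ⟩
          d ℕ.+ size q                                                     ≡⟨ cong (d ℕ.+_) (size-frame F q) ⟩
          d ℕ.+ (∣ q ! a ∣ ℕ.+ ∣ q ! b ∣ ℕ.+ ∣ q ! c ∣)                    ≡⟨ reassociate d ∣ q ! a ∣ ∣ q ! b ∣ ∣ q ! c ∣ ⟩
          d ℕ.+ ∣ q ! a ∣ ℕ.+ ∣ q ! b ∣ ℕ.+ ∣ q ! c ∣
            ≡⟨ cong (λ z → d ℕ.+ ∣ q ! a ∣ ℕ.+ ∣ z ∣ ℕ.+ ∣ q ! c ∣) eq ⟩
          d ℕ.+ ∣ q ! a ∣ ℕ.+ ∣ ι σ - q ! a - q ! c ∣ ℕ.+ ∣ q ! c ∣        ∎))))))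
        where
        open ≡-Reasoning
        reassociate : ∀ d x y z → d ℕ.+ (x ℕ.+ y ℕ.+ z) ≡ d ℕ.+ x ℕ.+ y ℕ.+ z
        reassociate = solve-∀ℕ

      near-sound : 1 ℕ.+ size q ≡ len → regionIn F supportV n q ≡ true → Lists near q
      near-sound = listed-sound 1 supportV near
        (λ σ → proj₁ (proj₂ (proj₂ (solve (Step.correct S σ) (correct σ) _))))

      far-sound : 3 ℕ.+ size q ≡ len → regionIn F linearV n q ≡ true → Lists far q
      far-sound = listed-sound 3 linearV far
        (λ σ → proj₁ (proj₂ (proj₂ (proj₂ (solve (Step.correct S σ) (correct σ) _)))))

-- The polynomials of the elements E, O, U, V

origin-0 : ∀ a → origin ! a ≡ 0ℤ
origin-0 r = refl
origin-0 s = refl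
origin-0 t = refl

at-size : ∀ {a b c} {F : Frame a b c} {q i j k} → At F q i j k → size q ≡ ∣ i ∣ ℕ.+ ∣ j ∣ ℕ.+ ∣ k ∣
at-size {F = F} {q} (coordinates refl refl refl) = size-frame F q

at-rotate : ∀ {a b c} {F : Frame a b c} {q i j k} → At F q i j k → At (rotate F) q j k i
at-rotate (coordinates x y z) = coordinates y z x

at-act : ∀ {a b c} {F : Frame a b c} {q i j k} → At F q i j k → At F (act a q) (1ℤ - i) (- k) (- j)
at-act {a} {F = F} {q} (coordinates refl refl refl) = coordinates (act-here a q) (act-there F q) (act-there (swap F) q)

at-reflect : ∀ {a b c} {F : Frame a b c} {q q′ i j k} n → q′ ≡ reflect a n q → At F q i j k →
             At F q′ (1ℤ + (n + n) - i) (- k - n) (- j - n)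
at-reflect {a} {F = F} {q} n refl (coordinates refl refl refl) =
  coordinates (reflect-here a n q) (reflect-there F n q) (reflect-there (swap F) n q)

at-act₂ : ∀ {a b c} {F : Frame a b c} {q i j k} → At F q i j k → At F (act b q) (- k) (1ℤ - j) (- i)
at-act₂ at with at-act (at-rotate at)
... | coordinates y z x = coordinates x y z

at-reflect₂ : ∀ {a b c} {F : Frame a b c} {q q′ i j k} n → q′ ≡ reflect b n q → At F q i j k →
              At F q′ (- k - n) (1ℤ + (n + n) - j) (- i - n)
at-reflect₂ n eq at with at-reflect n eq (at-rotate at)
... | coordinates y z x = coordinates x y z

at-≡ : ∀ {a b c} {F : Frame a b c} {q i j k i′ j′ k′} → i ≡ i′ → j ≡ j′ → k ≡ k′ → At F q i j k → At F q i′ j′ k′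
at-≡ refl refl refl h = h

at-~ : ∀ {a b c} {F : Frame a b c} {v w i j k} → At F (alcove v) i j k → At F (alcove w) i j k → v ~ w
at-~ {F = F} {v} {w} (coordinates x y z) (coordinates x′ y′ z′) = alcove-injective v w
  (alcove-ext F (trans x (sym x′)) (trans y (sym y′)) (trans z (sym z′)))

reflect-involutive : ∀ a n p → reflect a n (reflect a n p) ≡ p
reflect-involutive a n p with anyFrame a
... | b , c , F = alcove-ext F
  (trans (reflect-here a n _) (trans (cong (_-_ (1ℤ + (n + n))) (reflect-here a n p)) (lem₁ n (p ! a))))
  (opposite F) (opposite (swap F))
  where
  lem₁ : ∀ n x → 1ℤ + (n + n) - (1ℤ + (n + n) - x) ≡ x
  lem₁ = solve-∀
  lem₂ : ∀ n x → - (- x - n) - n ≡ x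
  lem₂ = solve-∀
  opposite : ∀ {b c} → Frame a b c → reflect a n (reflect a n p) ! b ≡ p ! b
  opposite {b} F = trans (reflect-there F n _) (trans (cong (λ z → - z - n) (reflect-there (swap F) n p)) (lem₂ n (p ! b)))

reflected : ∀ a n v → ∃ λ y → alcove y ≡ reflect a n (alcove v)
reflected a n v with reflection-reflect a n
... | g , x , h = (g ++ x ∷ reverse g) ++ v , trans (acts-++ (g ++ x ∷ reverse g) v origin) (h (alcove v))

Standard : Kind → ℕ → ∀ {a b c} → Frame a b c → Alcove → Set
Standard E m F q = At F q 0ℤ (+ m) (- + m)
Standard O m F q = At F q 0ℤ (+ m) (- + (m ∸ 1))
Standard U m F q = At F q 1ℤ (+ m) (- + m)
Standard V m F q = At F q 1ℤ (+ m) -[1+ m ]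

-- In a rotated frame this is definitionally `regionIn` of the matching piece, so known polynomials
-- enter a step without transport.
regionAt : Region → ℕ → ∀ {a b c} → Frame a b c → Alcove → Bool
regionAt R m {a} {b} {c} F q = contains R (q ! a) (q ! b) (q ! c) (+ m)

module Families (ℓ : Word → ℕ) (isLength : IsLengthFn ℓ) (P : Word → Word → Poly) (isKL : IsKL ℓ P) where

  open KazhdanLusztig ℓ isLength P isKL
  open IsKL isKL using (base-e; base-ne)

  at-ℓ : ∀ {a b c} {F : Frame a b c} {w i j k} → At F (alcove w) i j k → ℓ w ≡ ∣ i ∣ ℕ.+ ∣ j ∣ ℕ.+ ∣ k ∣
  at-ℓ {w = w} h = trans (ℓ-size w) (at-size h)

  ≤B-reflected : ∀ {u y v} a n → alcove y ≡ reflect a n (alcove v) → ℓ y ℕ.< ℓ v →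
                 _≤B_ ℓ u y → _≤B_ ℓ u v
  ≤B-reflected {v = v} a n eq = ≤B-reflect (reflection-reflect a n)
    (trans (sym (reflect-involutive a n (alcove v))) (cong (reflect a n) (sym eq)))

  ≤B⇒<B : ∀ {u v} → _≤B_ ℓ u v → ℓ u ℕ.< ℓ v → u <ᴮ v
  ≤B⇒<B le lt = le , λ h → ℕₚ.<-irrefl (ℓ-~ h) lt

  Known : Kind → ℕ → Set
  Known X m = ∀ {a b c} (F : Frame a b c) w → Standard X m F (alcove w) →
              Affine w (regionAt (support X) m F) (regionAt (linearPart X) m F)

  at-region : ∀ {a b c} {F : Frame a b c} p {n q i j k} → At F q i j k → inPiece p n i j k ≡ true → regionIn F p n q ≡ true
  at-region p (coordinates refl refl refl) h = h

  module Assemble (S : Step) (correct : Correct S) (n : ℕ) (admissible : Step.small S ≡ true → n ≡ 0)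
                  {a b c} (F : Frame a b c) (v : Word) (up : alcove v ! a ≤ 0ℤ)
                  (hv : Affine v (regionIn F (Step.supportV S) n) (regionIn F (Step.linearV S) n))
                  (len : ∀ x y → ⟦ Step.lengthV S ⟧ (x ∷ y ∷ + n ∷ []) ≡ + ℓ v) where

    open Step S hiding (correct)

    InLists : Alcove → Set
    InLists q = Lists S correct n admissible F near q ⊎ Lists S correct n admissible F far q

    -- The part common to all steps. What varies is the choice of words for the listed triples,
    -- their Bruhat relations and their polynomials; `vanish` follows by contraposition, since a
    -- nonzero coefficient puts z on a list and hence in Y.
    product : ∀ Y → Distinct Y → All (λ y → y <ᴮ v × 1ℤ ≤ alcove y ! a) Y →
      (∀ z → InLists (alcove z) → Any (z ~_) Y) →
      ∀ (α β : Alcove → ℤ) {Q′} →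
      (∀ x → sumP (map (term a v x) Y) ≗P quadratic (α (alcove x)) (β (alcove x))) →
      (∀ q → ι (Q′ q) + α q ≡ ι (regionIn F lhs₁ n q) + ι (regionIn F lhs₂ n q)) →
      (∀ q → ι (regionIn F quadraticPart n q) ≡ β q) →
      Affine (a ∷ v) (regionIn F supportW n) Q′
    product Y distinct below cover α β sums α≡ β≡ = affine-multiplication up hv α β record
      { ascends  = up
      ; distinct = distinct
      ; inside   = below
      ; vanish   = λ z lt h ¬p → μ-vanish hv z lt
          (λ eq → ¬-not λ inside → ¬p (cover z (inj₁ (near-sound S correct n admissible F (alcove z)
             (alcove-oriented z) h (ℓ v) len (trans (cong suc (sym (ℓ-size z))) eq) inside))))
          (λ eq → ¬-not λ inside → ¬p (cover z (inj₂ (far-sound S correct n admissible F (alcove z)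
             (alcove-oriented z) h (ℓ v) len (trans (cong (3 ℕ.+_) (sym (ℓ-size z))) eq) inside))))
      } sums
      (λ q o h → let e₀ , e₁ , e₂ = identities-descent S correct n admissible F q o h in
         e₀ , trans (α≡ q) e₁ , trans (cong ι e₂) (β≡ q))
      (λ q o h → let e₀ , e₁ , e₂ = identities-ascent S correct n admissible F q o h in
         e₀ , trans (α≡ q) e₁ , trans (cong ι e₂) (β≡ q))

  private
    no-terms : ∀ {g v} x → sumP (map (term g v x) []) ≗P quadratic 0ℤ 0ℤ
    no-terms x 0 = refl
    no-terms x 1 = refl
    no-terms x 2 = refl
    no-terms x (suc (suc (suc k))) = refl

    one-term : ∀ {p : Poly} {α β} → p ≗P quadratic α β → sumP (p ∷ []) ≗P quadratic α β
    one-term h k = trans (ℤₚ.+-identityʳ _) (h k)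

    two-terms : ∀ {p q : Poly} {α β α′ β′} → p ≗P quadratic α β → q ≗P quadratic α′ β′ →
                sumP (p ∷ q ∷ []) ≗P quadratic (α + α′) (β + β′)
    two-terms h h′ k = trans (cong₂ _+_ (h k) (one-term h′ k)) (lem k)
      where
      lem : ∀ {α β α′ β′} k → quadratic α β k + quadratic α′ β′ k ≡ quadratic (α + α′) (β + β′) k
      lem 0 = refl
      lem 1 = refl
      lem 2 = refl
      lem (suc (suc (suc k))) = refl

    -- Every step writes w as a(aw), with v = aw in a family already known.
    undo : ∀ a w → alcove (a ∷ a ∷ w) ≡ alcove w
    undo a w = act-involutive a (alcove w)

  known-V : ∀ n → Known O (2 ℕ.+ n) → Known E (1 ℕ.+ n) → Known V (1 ℕ.+ n)
  known-V n hO hE {a} {b} {c} F w at = affine-resp (undo a w)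
    (product (y ∷ []) ([] ∷ [])
      ((≤B⇒<B (≤B-reflected b 0ℤ (reflect-0 b (alcove v)) y<v (b-refl ~-refl)) y<v ,
        subst (1ℤ ≤_) (sym (first at-y)) (+≤+ (s≤s z≤n))) ∷ [])
      (λ { z (inj₁ (here at-z)) → here (at-~ at-z at-y) })
      (ι ∘ regionIn F lhs₂ n) (ι ∘ regionIn F quadraticPart n)
      (λ x → one-term (term₁ up hv (hE (rotate (rotate F)) y (at-rotate (at-rotate at-y)))
          ℓ-y (at-region supportV at-y (All.head (near-members stepV stepV-correct n (λ ())))) x))
      (λ q → refl) (λ q → refl))
    where
    open Step stepV using (supportV; linearV; lhs₂; quadraticPart; lengthV)
    v = a ∷ w
    at-v : At F (alcove v) 0ℤ (+ (2 ℕ.+ n)) -[1+ n ]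
    at-v = at-act at
    y = b ∷ v
    at-y : At F (alcove y) (+ (1 ℕ.+ n)) -[1+ n ] 0ℤ
    at-y = at-act₂ at-v
    up : alcove v ! a ≤ 0ℤ
    up = ℤₚ.≤-reflexive (first at-v)
    hv : Affine v (regionIn F supportV n) (regionIn F linearV n)
    hv = hO F v at-v
    ℓ-y : 1 ℕ.+ ℓ y ≡ ℓ v
    ℓ-y = trans (cong suc (at-ℓ at-y)) (trans (lem n) (sym (at-ℓ at-v)))
      where lem : ∀ n → 1 ℕ.+ (1 ℕ.+ n ℕ.+ (1 ℕ.+ n) ℕ.+ 0) ≡ 0 ℕ.+ (2 ℕ.+ n) ℕ.+ (1 ℕ.+ n)
            lem = solve-∀ℕ
    y<v : ℓ y ℕ.< ℓ v
    y<v = ℕₚ.≤-reflexive ℓ-y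
    len : ∀ x y → ⟦ lengthV ⟧ (x ∷ y ∷ + n ∷ []) ≡ + ℓ v
    len x y = cong +_ (sym (at-ℓ at-v))
    open Assemble stepV stepV-correct n (λ ()) F v up hv len

  known-U : ∀ n → Known E (2 ℕ.+ n) → Known O (2 ℕ.+ n) → Known U (1 ℕ.+ n) → Known U (2 ℕ.+ n)
  known-U n hE hO hU {a} {b} {c} F w at = affine-resp (undo a w)
    (product (y₁ ∷ y₂ ∷ []) ((y₁≁y₂ ∷ []) ∷ [] ∷ [])
      ((≤B⇒<B (≤B-reflected b (+ (1 ℕ.+ n)) y₁≡ y₁<v (b-refl ~-refl)) y₁<v ,
         ℤₚ.≤-reflexive (sym (first at-y₁))) ∷
       (≤B⇒<B (≤B-reflected b 0ℤ (reflect-0 b (alcove v)) y₂<v (b-refl ~-refl)) y₂<v ,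
         subst (1ℤ ≤_) (sym (first at-y₂)) (+≤+ (s≤s z≤n))) ∷ [])
      (λ { z (inj₁ (here at-z)) → here (at-~ at-z at-y₁)
         ; z (inj₁ (there (here at-z))) → there (here (at-~ at-z at-y₂)) })
      -- The linear part of `U` is empty, so `lhs₁` and `lhs₂` are both corrections, from y₁ and y₂.
      (λ q → ι (regionIn F lhs₁ n q) + ι (regionIn F lhs₂ n q)) (λ q → 0ℤ + ι (regionIn F quadraticPart n q))
      (λ x → two-terms
        (term₁ up hv (hU F y₁ at-y₁) ℓ-y₁ (at-region supportV at-y₁ (All.head members)) x)
        (term₁ up hv (hO (rotate (rotate F)) y₂ (at-rotate (at-rotate at-y₂))) ℓ-y₂
          (at-region supportV at-y₂ (All.head (All.tail members))) x))
      (λ q → ℤₚ.+-identityˡ _) (λ q → sym (ℤₚ.+-identityˡ _)))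
    where
    open Step stepU using (supportV; linearV; lhs₁; lhs₂; quadraticPart; lengthV)
    members = near-members stepU stepU-correct n (λ ())
    v = a ∷ w
    at-v : At F (alcove v) 0ℤ (+ (2 ℕ.+ n)) -[1+ 1 ℕ.+ n ]
    at-v = at-act at
    -- Hyperplane m exchanges the values m and m + 1 of its own coordinate; m = 1 + n brings 2 + n
    -- down to 1 + n.
    y₁ = proj₁ (reflected b (+ (1 ℕ.+ n)) v)
    y₁≡ : alcove y₁ ≡ reflect b (+ (1 ℕ.+ n)) (alcove v)
    y₁≡ = proj₂ (reflected b (+ (1 ℕ.+ n)) v)
    at-y₁ : At F (alcove y₁) 1ℤ (+ (1 ℕ.+ n)) -[1+ n ]
    at-y₁ = at-≡ (lem₁ (+ (1 ℕ.+ n))) (lem₂ (+ (1 ℕ.+ n))) refl (at-reflect₂ (+ (1 ℕ.+ n)) y₁≡ at-v)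
      where lem₁ : ∀ x → 1ℤ + x - x ≡ 1ℤ
            lem₁ = solve-∀
            lem₂ : ∀ x → 1ℤ + (x + x) - (1ℤ + x) ≡ x
            lem₂ = solve-∀
    y₂ = b ∷ v
    at-y₂ : At F (alcove y₂) (+ (2 ℕ.+ n)) -[1+ n ] 0ℤ
    at-y₂ = at-act₂ at-v
    y₁≁y₂ : ¬ y₁ ~ y₂
    y₁≁y₂ h with trans (sym (third at-y₁)) (trans (cong (_! c) (alcove-~ h)) (third at-y₂))
    ... | ()
    up : alcove v ! a ≤ 0ℤ
    up = ℤₚ.≤-reflexive (first at-v)
    hv : Affine v (regionIn F supportV n) (regionIn F linearV n)
    hv = hE F v at-v
    ℓ-y₁ : 1 ℕ.+ ℓ y₁ ≡ ℓ v
    ℓ-y₁ = trans (cong suc (at-ℓ at-y₁)) (trans (lem n) (sym (at-ℓ at-v)))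
      where lem : ∀ n → 1 ℕ.+ (1 ℕ.+ (1 ℕ.+ n) ℕ.+ (1 ℕ.+ n)) ≡ 0 ℕ.+ (2 ℕ.+ n) ℕ.+ (2 ℕ.+ n)
            lem = solve-∀ℕ
    ℓ-y₂ : 1 ℕ.+ ℓ y₂ ≡ ℓ v
    ℓ-y₂ = trans (cong suc (at-ℓ at-y₂)) (trans (lem n) (sym (at-ℓ at-v)))
      where lem : ∀ n → 1 ℕ.+ (2 ℕ.+ n ℕ.+ (1 ℕ.+ n) ℕ.+ 0) ≡ 0 ℕ.+ (2 ℕ.+ n) ℕ.+ (2 ℕ.+ n)
            lem = solve-∀ℕ
    y₁<v : ℓ y₁ ℕ.< ℓ v
    y₁<v = ℕₚ.≤-reflexive ℓ-y₁
    y₂<v : ℓ y₂ ℕ.< ℓ v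
    y₂<v = ℕₚ.≤-reflexive ℓ-y₂
    len : ∀ x y → ⟦ lengthV ⟧ (x ∷ y ∷ + n ∷ []) ≡ + ℓ v
    len x y = cong +_ (sym (at-ℓ at-v))
    open Assemble stepU stepU-correct n (λ ()) F v up hv len

  known-U₁ : Known E 1 → Known O 1 → Known U 1
  known-U₁ hE hO {a} {b} {c} F w at = affine-resp (undo a w)
    (product (y ∷ []) ([] ∷ [])
      ((≤B⇒<B (≤B-reflected b 0ℤ (reflect-0 b (alcove v)) y<v (b-refl ~-refl)) y<v ,
        ℤₚ.≤-reflexive (sym (first at-y))) ∷ [])
      (λ { z (inj₁ (here at-z)) → here (at-~ at-z at-y) })
      (ι ∘ regionIn F lhs₂ 0) (ι ∘ regionIn F quadraticPart 0)
      (λ x → one-term (term₁ up hv (hO (rotate (rotate F)) y (at-rotate (at-rotate at-y)))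
          ℓ-y (at-region supportV at-y (All.head (near-members stepU₁ stepU₁-correct 0 (λ _ → refl)))) x))
      (λ q → refl) (λ q → refl))
    where
    open Step stepU₁ using (supportV; linearV; lhs₂; quadraticPart; lengthV)
    v = a ∷ w
    at-v : At F (alcove v) 0ℤ 1ℤ -[1+ 0 ]
    at-v = at-act at
    y = b ∷ v
    at-y : At F (alcove y) 1ℤ 0ℤ 0ℤ
    at-y = at-act₂ at-v
    up : alcove v ! a ≤ 0ℤ
    up = ℤₚ.≤-reflexive (first at-v)
    hv : Affine v (regionIn F supportV 0) (regionIn F linearV 0)
    hv = hE F v at-v
    ℓ-y : 1 ℕ.+ ℓ y ≡ ℓ v
    ℓ-y = trans (cong suc (at-ℓ at-y)) (sym (at-ℓ at-v))
    y<v : ℓ y ℕ.< ℓ v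
    y<v = ℕₚ.≤-reflexive ℓ-y
    len : ∀ x y → ⟦ lengthV ⟧ (x ∷ y ∷ + 0 ∷ []) ≡ + ℓ v
    len x y = cong +_ (sym (at-ℓ at-v))
    open Assemble stepU₁ stepU₁-correct 0 (λ _ → refl) F v up hv len

  known-E : ∀ n → Known O (3 ℕ.+ n) → Known V (1 ℕ.+ n) → Known E (3 ℕ.+ n)
  known-E n hO hV {c} {a} {b} G w at = affine-resp (undo a w)
    (product (y ∷ []) ([] ∷ [])
      ((≤B⇒<B (≤B-reflected a -[1+ 0 ] y≡ y<v (b-refl ~-refl)) y<v ,
        subst (1ℤ ≤_) (sym (first at-y)) (+≤+ (s≤s z≤n))) ∷ [])
      (λ { z (inj₁ (here at-z)) → here (at-~ at-z at-y) })
      (ι ∘ regionIn F lhs₂ n) (ι ∘ regionIn F quadraticPart n)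
      (λ x → one-term (term₁ up hv (hV (rotate (rotate F)) y (at-rotate (at-rotate at-y)))
          ℓ-y (at-region supportV at-y (All.head (near-members stepE stepE-correct n (λ ())))) x))
      (λ q → refl) (λ q → refl))
    where
    open Step stepE using (supportV; linearV; lhs₂; quadraticPart; lengthV)
    F = rotate G
    v = a ∷ w
    at-v : At F (alcove v) -[1+ 1 ℕ.+ n ] 0ℤ (+ (3 ℕ.+ n))
    at-v = at-act (at-rotate at)
    -- Hyperplane -1 sends a coordinate i to -1 - i and adds 1 to the exchanged, negated other two,
    -- which yields the third coordinate 1 of a `V` element.
    y = proj₁ (reflected a -[1+ 0 ] v)
    y≡ : alcove y ≡ reflect a -[1+ 0 ] (alcove v)
    y≡ = proj₂ (reflected a -[1+ 0 ] v)
    at-y : At F (alcove y) (+ (1 ℕ.+ n)) -[1+ 1 ℕ.+ n ] 1ℤ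
    at-y = at-reflect -[1+ 0 ] y≡ at-v
    up : alcove v ! a ≤ 0ℤ
    up = subst (_≤ 0ℤ) (sym (first at-v)) -≤+
    hv : Affine v (regionIn F supportV n) (regionIn F linearV n)
    hv = hO (rotate F) v (at-rotate at-v)
    ℓ-y : 1 ℕ.+ ℓ y ≡ ℓ v
    ℓ-y = trans (cong suc (at-ℓ at-y)) (trans (lem n) (sym (at-ℓ at-v)))
      where lem : ∀ n → 1 ℕ.+ (1 ℕ.+ n ℕ.+ (2 ℕ.+ n) ℕ.+ 1) ≡ 2 ℕ.+ n ℕ.+ 0 ℕ.+ (3 ℕ.+ n)
            lem = solve-∀ℕ
    y<v : ℓ y ℕ.< ℓ v
    y<v = ℕₚ.≤-reflexive ℓ-y
    len : ∀ x y → ⟦ lengthV ⟧ (x ∷ y ∷ + n ∷ []) ≡ + ℓ v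
    len x y = cong +_ (trans (lem n) (sym (at-ℓ at-v)))
      where lem : ∀ n → 3 ℕ.+ n ℕ.+ (2 ℕ.+ n) ≡ 2 ℕ.+ n ℕ.+ 0 ℕ.+ (3 ℕ.+ n)
            lem = solve-∀ℕ
    open Assemble stepE stepE-correct n (λ ()) F v up hv len

  known-E₂ : Known O 2 → Known E 2
  known-E₂ hO {c} {a} {b} G w at = affine-resp (undo a w)
    (product [] [] [] (λ { z (inj₁ ()) ; z (inj₂ ()) }) (λ _ → 0ℤ) (λ _ → 0ℤ) (no-terms {a} {v})
      (λ q → refl) (λ q → refl))
    where
    open Step stepE₂ using (supportV; linearV)
    F = rotate G
    v = a ∷ w
    at-v : At F (alcove v) -[1+ 0 ] 0ℤ (+ 2)
    at-v = at-act (at-rotate at)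
    up : alcove v ! a ≤ 0ℤ
    up = subst (_≤ 0ℤ) (sym (first at-v)) -≤+
    hv : Affine v (regionIn F supportV 0) (regionIn F linearV 0)
    hv = hO (rotate F) v (at-rotate at-v)
    open Assemble stepE₂ stepE₂-correct 0 (λ _ → refl) F v up hv (λ _ _ → cong +_ (sym (at-ℓ at-v)))

  known-E₁ : Known O 1 → Known E 1
  known-E₁ hO {c} {a} {b} G w at = affine-resp (undo a w)
    (product [] [] [] (λ { z (inj₁ ()) ; z (inj₂ ()) }) (λ _ → 0ℤ) (λ _ → 0ℤ) (no-terms {a} {v})
      (λ q → refl) (λ q → refl))
    where
    open Step stepE₁ using (supportV; linearV)
    F = rotate G
    v = a ∷ w
    at-v : At F (alcove v) 0ℤ 0ℤ 1ℤ
    at-v = at-act (at-rotate at)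
    up : alcove v ! a ≤ 0ℤ
    up = ℤₚ.≤-reflexive (first at-v)
    hv : Affine v (regionIn F supportV 0) (regionIn F linearV 0)
    hv = hO (rotate F) v (at-rotate at-v)
    open Assemble stepE₁ stepE₁-correct 0 (λ _ → refl) F v up hv (λ _ _ → cong +_ (sym (at-ℓ at-v)))

  known-O : ∀ n → Known E (3 ℕ.+ n) → Known U (2 ℕ.+ n) → Known U (1 ℕ.+ n) → Known O (4 ℕ.+ n)
  known-O n hE hU hU′ {c} {a} {b} G w at = affine-resp (undo a w)
    (product (y ∷ y′ ∷ []) ((y≁y′ ∷ []) ∷ [] ∷ [])
      ((≤B⇒<B (y≤v (b-refl ~-refl)) (ℕₚ.≤-reflexive ℓ-y) ,
         subst (1ℤ ≤_) (sym (first at-y)) (+≤+ (s≤s z≤n))) ∷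
       (≤B⇒<B (y≤v (≤B-reflected a (+ (1 ℕ.+ n)) x≡ (ℕₚ.≤-reflexive ℓ-x)
                 (≤B-reflected b -[1+ 1 ℕ.+ n ] y′≡ (ℕₚ.≤-reflexive ℓ-y′x) (b-refl ~-refl)))) y′<v ,
         subst (1ℤ ≤_) (sym (first at-y′)) (+≤+ (s≤s z≤n))) ∷ [])
      (λ { z (inj₁ (here at-z)) → here (at-~ at-z at-y)
         ; z (inj₂ (here at-z)) → there (here (at-~ at-z at-y′)) })
      (λ q → ι (regionIn F lhs₂ n q) + 0ℤ) (λ q → 0ℤ + ι (regionIn F quadraticPart n q))
      (λ x → two-terms
        (term₁ up hv (hU (rotate (rotate F)) y (at-rotate (at-rotate at-y))) ℓ-y
          (at-region supportV at-y (All.head (near-members stepO stepO-correct n (λ ())))) x)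
        (term₃ up hv (hU′ (rotate (rotate F)) y′ (at-rotate (at-rotate at-y′))) ℓ-y′
          (at-region linearV at-y′ (All.head (far-members stepO stepO-correct n (λ ())))) x))
      (λ q → cong (_+_ (ι (regionIn F lhs₁ n q))) (ℤₚ.+-identityʳ _)) (λ q → sym (ℤₚ.+-identityˡ _)))
    where
    open Step stepO using (supportV; linearV; lhs₁; lhs₂; quadraticPart; lengthV)
    F = rotate G
    v = a ∷ w
    at-v : At F (alcove v) -[1+ 2 ℕ.+ n ] 0ℤ (+ (3 ℕ.+ n))
    at-v = at-act (at-rotate at)
    y = proj₁ (reflected a -[1+ 0 ] v)
    y≡ : alcove y ≡ reflect a -[1+ 0 ] (alcove v)
    y≡ = proj₂ (reflected a -[1+ 0 ] v)
    at-y : At F (alcove y) (+ (2 ℕ.+ n)) -[1+ 1 ℕ.+ n ] 1ℤ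
    at-y = at-reflect -[1+ 0 ] y≡ at-v
    -- An intermediate element: y′ is three shorter than v, and y′ < v is witnessed by the chain v,
    -- y, x, y′ of reflections, each lowering the length by one.
    x = proj₁ (reflected a (+ (1 ℕ.+ n)) y)
    x≡ : alcove x ≡ reflect a (+ (1 ℕ.+ n)) (alcove y)
    x≡ = proj₂ (reflected a (+ (1 ℕ.+ n)) y)
    at-x : At F (alcove x) (+ (1 ℕ.+ n)) -[1+ 1 ℕ.+ n ] 1ℤ
    at-x = at-≡ (lem₁ (+ (1 ℕ.+ n))) refl (lem₂ (+ (1 ℕ.+ n))) (at-reflect (+ (1 ℕ.+ n)) x≡ at-y)
      where lem₁ : ∀ x → 1ℤ + (x + x) - (1ℤ + x) ≡ x
            lem₁ = solve-∀
            lem₂ : ∀ x → 1ℤ + x - x ≡ 1ℤ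
            lem₂ = solve-∀
    y′ = proj₁ (reflected b -[1+ 1 ℕ.+ n ] x)
    y′≡ : alcove y′ ≡ reflect b -[1+ 1 ℕ.+ n ] (alcove x)
    y′≡ = proj₂ (reflected b -[1+ 1 ℕ.+ n ] x)
    at-y′ : At F (alcove y′) (+ (1 ℕ.+ n)) -[1+ n ] 1ℤ
    at-y′ = at-≡ refl (lem₁ -[1+ 1 ℕ.+ n ]) (lem₂ (+ (1 ℕ.+ n))) (at-reflect₂ -[1+ 1 ℕ.+ n ] y′≡ at-x)
      where lem₁ : ∀ x → 1ℤ + (x + x) - x ≡ 1ℤ + x
            lem₁ = solve-∀
            lem₂ : ∀ x → - x - - (1ℤ + x) ≡ 1ℤ
            lem₂ = solve-∀
    up : alcove v ! a ≤ 0ℤ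
    up = subst (_≤ 0ℤ) (sym (first at-v)) -≤+
    hv : Affine v (regionIn F supportV n) (regionIn F linearV n)
    hv = hE (rotate F) v (at-rotate at-v)
    ℓ-y : 1 ℕ.+ ℓ y ≡ ℓ v
    ℓ-y = trans (cong suc (at-ℓ at-y)) (trans (lem n) (sym (at-ℓ at-v)))
      where lem : ∀ n → 1 ℕ.+ (2 ℕ.+ n ℕ.+ (2 ℕ.+ n) ℕ.+ 1) ≡ 3 ℕ.+ n ℕ.+ 0 ℕ.+ (3 ℕ.+ n)
            lem = solve-∀ℕ
    ℓ-x : 1 ℕ.+ ℓ x ≡ ℓ y
    ℓ-x = trans (cong suc (at-ℓ at-x)) (sym (at-ℓ at-y))
    ℓ-y′x : 1 ℕ.+ ℓ y′ ≡ ℓ x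
    ℓ-y′x = trans (cong suc (at-ℓ at-y′)) (trans (lem n) (sym (at-ℓ at-x)))
      where lem : ∀ n → 1 ℕ.+ (1 ℕ.+ n ℕ.+ (1 ℕ.+ n) ℕ.+ 1) ≡ 1 ℕ.+ n ℕ.+ (2 ℕ.+ n) ℕ.+ 1
            lem = solve-∀ℕ
    ℓ-y′ : 3 ℕ.+ ℓ y′ ≡ ℓ v
    ℓ-y′ = trans (cong (2 ℕ.+_) ℓ-y′x) (trans (cong suc ℓ-x) ℓ-y)
    y′<v : ℓ y′ ℕ.< ℓ v
    y′<v = ℕₚ.≤-trans (s≤s (ℕₚ.m≤n+m (ℓ y′) 2)) (ℕₚ.≤-reflexive ℓ-y′)
    y≤v : ∀ {u} → _≤B_ ℓ u y → _≤B_ ℓ u v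
    y≤v = ≤B-reflected a -[1+ 0 ] y≡ (ℕₚ.≤-reflexive ℓ-y)
    y≁y′ : ¬ y ~ y′
    y≁y′ h = ℕₚ.m≢1+n+m (ℓ y′) (sym (trans (cong suc ℓ-y′x) (trans ℓ-x (ℓ-~ h))))
    len : ∀ x y → ⟦ lengthV ⟧ (x ∷ y ∷ + n ∷ []) ≡ + ℓ v
    len x y = cong +_ (trans (lem n) (sym (at-ℓ at-v)))
      where lem : ∀ n → 3 ℕ.+ n ℕ.+ (3 ℕ.+ n) ≡ 3 ℕ.+ n ℕ.+ 0 ℕ.+ (3 ℕ.+ n)
            lem = solve-∀ℕ
    open Assemble stepO stepO-correct n (λ ()) F v up hv len

  known-O₂ : Known E 2 → Known U 1 → Known O 3
  known-O₂ hE hU {c} {a} {b} G w at = affine-resp (undo a w)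
    (product (y ∷ []) ([] ∷ [])
      ((≤B⇒<B (≤B-reflected a -[1+ 0 ] y≡ y<v (b-refl ~-refl)) y<v ,
        ℤₚ.≤-reflexive (sym (first at-y))) ∷ [])
      (λ { z (inj₁ (here at-z)) → here (at-~ at-z at-y) })
      (ι ∘ regionIn F lhs₂ 0) (ι ∘ regionIn F quadraticPart 0)
      (λ x → one-term (term₁ up hv (hU (rotate (rotate F)) y (at-rotate (at-rotate at-y)))
          ℓ-y (at-region supportV at-y (All.head (near-members stepO₂ stepO₂-correct 0 (λ _ → refl)))) x))
      (λ q → refl) (λ q → refl))
    where
    open Step stepO₂ using (supportV; linearV; lhs₂; quadraticPart; lengthV)
    F = rotate G
    v = a ∷ w
    at-v : At F (alcove v) -[1+ 1 ] 0ℤ (+ 2)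
    at-v = at-act (at-rotate at)
    y = proj₁ (reflected a -[1+ 0 ] v)
    y≡ : alcove y ≡ reflect a -[1+ 0 ] (alcove v)
    y≡ = proj₂ (reflected a -[1+ 0 ] v)
    at-y : At F (alcove y) 1ℤ -[1+ 0 ] 1ℤ
    at-y = at-reflect -[1+ 0 ] y≡ at-v
    up : alcove v ! a ≤ 0ℤ
    up = subst (_≤ 0ℤ) (sym (first at-v)) -≤+
    hv : Affine v (regionIn F supportV 0) (regionIn F linearV 0)
    hv = hE (rotate F) v (at-rotate at-v)
    ℓ-y : 1 ℕ.+ ℓ y ≡ ℓ v
    ℓ-y = trans (cong suc (at-ℓ at-y)) (sym (at-ℓ at-v))
    y<v : ℓ y ℕ.< ℓ v
    y<v = ℕₚ.≤-reflexive ℓ-y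
    open Assemble stepO₂ stepO₂-correct 0 (λ _ → refl) F v up hv (λ _ _ → cong +_ (sym (at-ℓ at-v)))

  known-O₁ : Known E 1 → Known O 2
  known-O₁ hE {c} {a} {b} G w at = affine-resp (undo a w)
    (product [] [] [] (λ { z (inj₁ ()) ; z (inj₂ ()) }) (λ _ → 0ℤ) (λ _ → 0ℤ) (no-terms {a} {v})
      (λ q → refl) (λ q → refl))
    where
    open Step stepO₁ using (supportV; linearV)
    F = rotate G
    v = a ∷ w
    at-v : At F (alcove v) -[1+ 0 ] 0ℤ 1ℤ
    at-v = at-act (at-rotate at)
    up : alcove v ! a ≤ 0ℤ
    up = subst (_≤ 0ℤ) (sym (first at-v)) -≤+
    hv : Affine v (regionIn F supportV 0) (regionIn F linearV 0)
    hv = hE (rotate F) v (at-rotate at-v)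
    open Assemble stepO₁ stepO₁-correct 0 (λ _ → refl) F v up hv (λ _ _ → cong +_ (sym (at-ℓ at-v)))

  affine-identity : ∀ {a b c} (F : Frame a b c) →
    Affine [] (regionIn F (piece identity abc 0) 0) (λ _ → false)
  affine-identity {a} {b} {c} F = mkAffine λ x → go x (x ~? [])
    where
    R = regionIn F (piece identity abc 0) 0
    at-origin : ∀ x → At F (alcove x) 0ℤ 0ℤ 0ℤ → x ~ []
    at-origin x at = at-~ at (coordinates (origin-0 a) (origin-0 b) (origin-0 c))
    R-origin : R origin ≡ true
    R-origin = cong₃ (inPiece (piece identity abc 0) 0) (origin-0 a) (origin-0 b) (origin-0 c)
    R-true : ∀ x → R (alcove x) ≡ true → x ~ []
    R-true x eq with ev-sound (form identity (var zero) (var (suc zero)) (var (suc (suc zero))) (var (suc (suc (suc zero)))))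
                              {alcove x ! a ∷ alcove x ! b ∷ alcove x ! c ∷ 0ℤ ∷ []} (Equivalence.from T-≡ eq)
    ... | hi , hj , hk = at-origin x (coordinates (≐-elim hi) (≐-elim hj) (≐-elim hk))
    one : oneP ≗P affine true false
    one 0             = refl
    one 1             = refl
    one (suc (suc k)) = refl
    none : zeroP ≗P affine false false
    none 0             = refl
    none 1             = refl
    none (suc (suc k)) = refl
    go : ∀ x → Dec (x ~ []) → P x [] ≗P affine (R (alcove x)) false
    go x (yes h) k = trans (base-e x h k) (trans (one k)
      (cong (λ z → affine z false k) (sym (trans (cong R (alcove-~ h)) R-origin))))
    go x (no ¬h) k = trans (base-ne x ¬h k) (trans (none k)
      (cong (λ z → affine z false k) (sym (¬-not (¬h ∘ R-true x)))))

  known-O₀ : Known O 1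
  known-O₀ {c} {a} {b} G w at = affine-resp (undo a w)
    (product [] [] [] (λ { z (inj₁ ()) ; z (inj₂ ()) }) (λ _ → 0ℤ) (λ _ → 0ℤ) (no-terms {a} {v})
      (λ q → refl) (λ q → refl))
    where
    open Step stepO₀ using (supportV; linearV)
    F = rotate G
    v = a ∷ w
    at-v : At F (alcove v) 0ℤ 0ℤ 0ℤ
    at-v = at-act (at-rotate at)
    up : alcove v ! a ≤ 0ℤ
    up = ℤₚ.≤-reflexive (first at-v)
    hv : Affine v (regionIn F supportV 0) (regionIn F linearV 0)
    hv = affine-resp (sym (alcove-ext F (trans (first at-v) (sym (origin-0 a))) (trans (second at-v) (sym (origin-0 b)))
      (trans (third at-v) (sym (origin-0 c))))) (affine-identity F)
    open Assemble stepO₀ stepO₀-correct 0 (λ _ → refl) F v up hv (λ _ _ → cong +_ (sym (at-ℓ at-v)))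

  -- The relation for `O` uses `U` two and three levels down, hence three base cases. `V` depends on
  -- `O` and `E` alone, so it is rebuilt where needed instead of being carried along.
  known : ∀ n → Known O (1 ℕ.+ n) × Known E (1 ℕ.+ n) × Known U (1 ℕ.+ n)
  known 0 = O₁ , E₁ , known-U₁ E₁ O₁
    where
    O₁ : Known O 1
    O₁ = known-O₀
    E₁ : Known E 1
    E₁ = known-E₁ O₁
  known 1 = let O₁ , E₁ , U₁ = known 0
                O₂ : Known O 2
                O₂ = known-O₁ E₁
                E₂ : Known E 2
                E₂ = known-E₂ O₂
            in O₂ , E₂ , known-U 0 E₂ O₂ U₁
  known 2 = let O₁ , E₁ , U₁ = known 0
                O₂ , E₂ , U₂ = known 1
                O₃ : Known O 3
                O₃ = known-O₂ E₂ U₁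
                E₃ : Known E 3
                E₃ = known-E 0 O₃ (known-V 0 O₂ E₁)
            in O₃ , E₃ , known-U 1 E₃ O₃ U₂
  known (suc (suc (suc n))) =
    let O₁ , E₁ , U₁ = known n
        O₂ , E₂ , U₂ = known (suc n)
        O₃ , E₃ , U₃ = known (suc (suc n))
        O₄ : Known O (4 ℕ.+ n)
        O₄ = known-O n E₃ U₂ U₁
        E₄ : Known E (4 ℕ.+ n)
        E₄ = known-E (1 ℕ.+ n) O₄ (known-V (1 ℕ.+ n) O₃ E₂)
    in O₄ , E₄ , known-U (2 ℕ.+ n) E₄ O₄ U₃

-- The elements of c₁

distinct-gens : ∀ {a b c} → Frame a b c → a ≢ b
distinct-gens rst ()
distinct-gens str ()
distinct-gens trs ()
distinct-gens rts ()
distinct-gens tsr ()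
distinct-gens srt ()

descending-~ : ∀ {w v} → Descending (alcove w) v → v ~ w
descending-~ {w} d = ~-sym (~-descending w d)

walk : ∀ {a p} → Oriented p → 1ℤ ≤ p ! a → ∃ λ w → Descending p (a ∷ w)
walk {a} {p} o h with descending (act a p) (act-oriented a {p} o)
... | w , d = w , down h d

two-descents : ∀ {a b c} → Frame a b c → ∀ {w} → InC1 w → 1ℤ ≤ alcove w ! a → 1ℤ ≤ alcove w ! b → ⊥
two-descents {a} {b} F {w} (_ , unique) x y with walk {a} (alcove-oriented w) x | walk {b} (alcove-oriented w) y
... | u , d | v , e with unique (a ∷ u) (b ∷ v) (descending-reduced d) (descending-reduced e) (descending-~ d) (descending-~ e)
... | refl = distinct-gens F refl

-- Removing a exchanges and negates the other two coordinates, which become positive: reduced words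
-- starting with ab and with ac both exist.
two-later-descents : ∀ {a b c} → Frame a b c → ∀ {w} → InC1 w → 1ℤ ≤ alcove w ! a →
                     alcove w ! b ≤ -[1+ 0 ] → alcove w ! c ≤ -[1+ 0 ] → ⊥
two-later-descents {a} {b} {c} F {w} (_ , unique) x y z
  with walk {c} {act a (alcove w)} o (subst (1ℤ ≤_) (sym (act-there (swap F) (alcove w))) (ℤₚ.neg-mono-≤ y))
     | walk {b} {act a (alcove w)} o (subst (1ℤ ≤_) (sym (act-there F (alcove w))) (ℤₚ.neg-mono-≤ z))
  where o = act-oriented a {alcove w} (alcove-oriented w)
... | u , d | v , e with unique (a ∷ c ∷ u) (a ∷ b ∷ v) (descending-reduced (down x d)) (descending-reduced (down x e))
                           (descending-~ (down x d)) (descending-~ (down x e))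
... | refl = distinct-gens (rotate F) refl

data Shape (w : Word) : Set where
  even : ∀ {a b c} (F : Frame a b c) n → Standard E (1 ℕ.+ n) F (alcove w) → Shape w
  odd  : ∀ {a b c} (F : Frame a b c) n → Standard O (1 ℕ.+ n) F (alcove w) → Shape w

data Sign (x : ℤ) : Set where
  pos : 1ℤ ≤ x → Sign x
  nul : x ≡ 0ℤ → Sign x
  neg : x ≤ -[1+ 0 ] → Sign x

sign : ∀ x → Sign x
sign +0       = nul refl
sign +[1+ n ] = pos (+≤+ (s≤s z≤n))
sign -[1+ n ] = neg (ℤ.-≤- z≤n)

on-wall : ∀ {a b c} (F : Frame a b c) w → ¬ (w ~ []) → alcove w ! a ≡ 0ℤ → Shape w
on-wall {a} {b} {c} F w w≁e i≡0 = go (alcove-oriented w)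
  where
  c-value : ∀ {x} → total (alcove w) ≡ x → alcove w ! c ≡ x - alcove w ! b
  c-value {x} eq = trans (lem (alcove w ! b) (alcove w ! c)) (cong (_- alcove w ! b)
    (trans (cong (λ i → i + alcove w ! b + alcove w ! c) (sym i≡0)) (trans (sym (total-frame F (alcove w))) eq)))
    where lem : ∀ y z → z ≡ 0ℤ + y + z - y
          lem = solve-∀
  even-wall : ∀ y {z} → alcove w ! b ≡ y → alcove w ! c ≡ z → z ≡ 0ℤ - y → Shape w
  even-wall +0       eqb eqc refl = ⊥-elim (w≁e (at-~ {F = F} (coordinates i≡0 eqb eqc)
                                      (coordinates (origin-0 a) (origin-0 b) (origin-0 c))))
  even-wall +[1+ n ] eqb eqc refl = even F n (coordinates i≡0 eqb eqc)
  even-wall -[1+ n ] eqb eqc refl = even (swap F) n (coordinates i≡0 eqc eqb)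
  odd-wall : ∀ y {z} → alcove w ! b ≡ y → alcove w ! c ≡ z → z ≡ 1ℤ - y → Shape w
  odd-wall +0             eqb eqc refl = odd (swap F) 0 (coordinates i≡0 eqc eqb)
  odd-wall +[1+ zero ]    eqb eqc refl = odd F 0 (coordinates i≡0 eqb eqc)
  odd-wall +[1+ suc n ]   eqb eqc refl = odd F (1 ℕ.+ n) (coordinates i≡0 eqb eqc)
  odd-wall -[1+ n ]       eqb eqc refl = odd (swap F) (1 ℕ.+ n) (coordinates i≡0 eqc eqb)
  go : Oriented (alcove w) → Shape w
  go (inj₁ h) = even-wall (alcove w ! b) refl refl (c-value h)
  go (inj₂ h) = odd-wall (alcove w ! b) refl refl (c-value h)

-- If no coordinate vanishes, two positive ones give two first letters, a single positive one gives
-- two second letters, and three negative ones contradict the orientation.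
c₁-shape : ∀ w → InC1 w → Shape w
c₁-shape w h@(w≁e , _) with sign (alcove w ! r) | sign (alcove w ! s) | sign (alcove w ! t)
... | nul x | _     | _     = on-wall rst w w≁e x
... | _     | nul y | _     = on-wall str w w≁e y
... | _     | _     | nul z = on-wall trs w w≁e z
... | pos x | pos y | _     = ⊥-elim (two-descents rst h x y)
... | pos x | neg _ | pos z = ⊥-elim (two-descents rts h x z)
... | neg _ | pos y | pos z = ⊥-elim (two-descents str h y z)
... | pos x | neg y | neg z = ⊥-elim (two-later-descents rst h x y z)
... | neg x | pos y | neg z = ⊥-elim (two-later-descents str h y z x)
... | neg x | neg y | pos z = ⊥-elim (two-later-descents trs h z x y)
... | neg x | neg y | neg z = ⊥-elim (impossible (alcove-oriented w))
  where
  total≤-3 : total (alcove w) ≤ -[1+ 2 ]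
  total≤-3 = ℤₚ.+-mono-≤ (ℤₚ.+-mono-≤ x y) z
  impossible : Oriented (alcove w) → ⊥
  impossible (inj₁ h) with subst (_≤ -[1+ 2 ]) h total≤-3
  ... | ()
  impossible (inj₂ h) with subst (_≤ -[1+ 2 ]) h total≤-3
  ... | ()

-- The coefficient read off for odd d has index (d - 1)/2, which is at least 2 from d = 5 on.
halfCoeff-≥5 : ∀ d {p : Poly} → 5 ℕ.≤ d → (∀ k → p (2 ℕ.+ k) ≡ 0ℤ) → halfCoeff d p ≡ 0ℤ
halfCoeff-≥5 (suc (suc (suc (suc d)))) _ h = halfCoeff-0 d h
halfCoeff-≥5 1 (s≤s ()) h
halfCoeff-≥5 2 (s≤s (s≤s ())) h
halfCoeff-≥5 3 (s≤s (s≤s (s≤s ()))) h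

theorem6p11 : (ℓ : Word → ℕ) → IsLengthFn ℓ →
    (P : Word → Word → Poly) → IsKL ℓ P →
    ∀ u w → _<B_ ℓ u w → InC0 u → InC1 w →
    5 ℕ.≤ ℓ w ∸ ℓ u → mu ℓ P u w ≡ 0ℤ
theorem6p11 ℓ isLength P isKL u w _ _ w∈c₁ d≥5 = halfCoeff-≥5 (ℓ w ∸ ℓ u) d≥5 (high (c₁-shape w w∈c₁))
  where
  open Families ℓ isLength P isKL
  open KazhdanLusztig ℓ isLength P isKL using (coefficients)
  high : Shape w → ∀ k → P u w (2 ℕ.+ k) ≡ 0ℤ
  high (even F n at) k = coefficients (proj₁ (proj₂ (known n)) F w at) u (2 ℕ.+ k)
  high (odd F n at)  k = coefficients (proj₁ (known n) F w at) u (2 ℕ.+ k)
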